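{- Let $\Omega$ be a proper countable $D$-set with a unary predicate $P$ such that $P\neq\emptyset$ and $P\neq\Omega$. Then $\Omega$ is $P$-homogeneous if and only if all of the following hold: (1) $\Omega$ is dense; (2) any two node splittings of $P$ (viewed as a $D$-set with the induced relation) have the same number of sectors (either a natural number greater than $2$ or $\aleph_0$), and likewise any two node splittings of $\Omega\setminus P$ have the same number of sectors; (3) one of the following holds: (a) for every infinite sector $\Sigma$ of every splitting of $\Omega$, $\Sigma\cap P\neq\emptyset$ and $\Sigma\setminus P\neq\emptyset$; (b) $\{P,\Omega\setminus P\}$ is a true edge splitting of $\Omega$; (c) $|P|=1$ or $|\Omega\setminus P|=1$.
   Context: A $D$-set is a set $\Omega$ with a quaternary relation $D$, written $D(wx;yz)$, such that for all $w,x,y,z\in\Omega$: (D1) $D(wx;yz)\to (D(xw;yz)\wedge D(yz;wx))$; (D2) $D(wx;yz)\to\neg D(wy;xz)$; (D3) $D(wx;yz)\to\forall v\,(D(vx;yz)\vee D(wx;yv))$; (D4) $(w\neq y\wedge x\neq y)\to D(wx;yy)$. It is proper if $|\Omega|\ge 3$ and whenever $w,x,y$ are pairwise distinct there is $z\neq y$ with $D(wx;yz)$. It is dense if $|\Omega|\ge 2$ and $D(wx;yz)$ implies there is $v$ with $D(vx;yz)\wedge D(wv;yz)\wedge D(wx;vz)\wedge D(wx;yv)$. A splitting of a $D$-set $X$ is a partition of $X$ into at least two parts (sectors) such that (i) if $a,b$ lie in a part $\Sigma$ and $c,d\in X\setminus\Sigma$ then $D(ab;cd)$, and (ii) if $a,b,c,d$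 lie in four distinct parts then $\neg D(ab;cd)$. A node splitting has more than two sectors; an edge splitting has exactly two; a true edge splitting is an edge splitting which has no refinement that is a node splitting and none of whose sectors is a singleton. The structure $(\Omega;D,P)$ is $P$-homogeneous if whenever $A,B$ are finite substructures with $A\cap P$, $A\setminus P$, $B\cap P$, $B\setminus P$ all nonempty, every isomorphism $A\to B$ (preserving $D$ and $P$) extends to an automorphism of $(\Omega;D,P)$. -}

module Defs where

open import Level using (Level) renaming (suc to lsuc; zero to lzero)
open import Data.Nat using (ℕ)
open import Data.Bool using (Bool; true; false)
open import Data.Unit using (⊤)
open import Data.Fin using (Fin)
open import Data.List using (List)
open import Data.List.Membership.Propositional using (_∈_)
open import Data.Product using (Σ; ∃; _×_; _,_)
open import Data.Sum using (_⊎_)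
open import Relation.Nullary using (¬_)
open import Relation.Binary.PropositionalEquality using (_≡_; _≢_)
open import Function.Bundles using (_↔_; _⇔_)
open import Function.Definitions using (Injective)

Countable : Set → Set
Countable Ω = Σ (Ω → ℕ) λ c → Injective _≡_ _≡_ c

Subset : Set → Set₁
Subset Ω = Ω → Set

Infinite : {Ω : Set} → Subset Ω → Set
Infinite {Ω} S = ¬ (Σ (List Ω) λ xs → ∀ x → S x → x ∈ xs)

module _ {Ω : Set} (D : Ω → Ω → Ω → Ω → Set) where

  record IsDSet : Set where
    field
      D1 : ∀ w x y z → D w x y z → D x w y z × D y z w x
      D2 : ∀ w x y z → D w x y z → ¬ D w y x z
      D3 : ∀ w x y z → D w x y z → ∀ v → D v x y z ⊎ D w x y v
      D4 : ∀ w x y → w ≢ y → x ≢ y → D w x y y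

  IsProper : Set
  IsProper =
    (Σ Ω λ a → Σ Ω λ b → Σ Ω λ c → a ≢ b × a ≢ c × b ≢ c)
    × (∀ w x y → w ≢ x → w ≢ y → x ≢ y → Σ Ω λ z → z ≢ y × D w x y z)

  IsDense : Set
  IsDense =
    (Σ Ω λ a → Σ Ω λ b → a ≢ b)
    × (∀ w x y z → D w x y z →
         Σ Ω λ v → D v x y z × D w v y z × D w x v z × D w x y v)

  -- A splitting of the D-set X ⊆ Ω (with the induced relation), given by a
  -- labelling f : Ω → I whose restriction to X is onto I; the sectors are
  -- the fibres {x ∈ X | f x ≡ i}, i : I (labels outside X are irrelevant).
  record IsSplitting (X : Subset Ω) (I : Set) (f : Ω → I) : Set where
    field
      onto      : ∀ i → Σ Ω λ x → X x × f x ≡ i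
      twoParts  : Σ Ω λ a → Σ Ω λ b → X a × X b × f a ≢ f b
      sectorCond : ∀ a b c d → X a → X b → X c → X d →
                   f a ≡ f b → f c ≢ f a → f d ≢ f a → D a b c d
      fourCond  : ∀ a b c d → X a → X b → X c → X d →
                  f a ≢ f b → f a ≢ f c → f a ≢ f d →
                  f b ≢ f c → f b ≢ f d → f c ≢ f d → ¬ D a b c d

  MoreThanTwo : (X : Subset Ω) {I : Set} (f : Ω → I) → Set
  MoreThanTwo X f = Σ Ω λ a → Σ Ω λ b → Σ Ω λ c → X a × X b × X c ×
                    f a ≢ f b × f a ≢ f c × f b ≢ f c

  IsNodeSplitting : (X : Subset Ω) (I : Set) (f : Ω → I) → Set
  IsNodeSplitting X I f = IsSplitting X I f × MoreThanTwo X f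

  IsEdgeSplitting : (X : Subset Ω) (I : Set) (f : Ω → I) → Set
  IsEdgeSplitting X I f = IsSplitting X I f × ¬ MoreThanTwo X f

  Refines : (X : Subset Ω) {I J : Set} (g : Ω → J) (f : Ω → I) → Set
  Refines X g f = ∀ x y → X x → X y → g x ≡ g y → f x ≡ f y

  HasSingletonSector : (X : Subset Ω) {I : Set} (f : Ω → I) → Set
  HasSingletonSector X f = Σ Ω λ x → X x × (∀ y → X y → f y ≡ f x → y ≡ x)

  IsTrueEdgeSplitting : (X : Subset Ω) (I : Set) (f : Ω → I) → Set₁
  IsTrueEdgeSplitting X I f =
    IsEdgeSplitting X I f
    × (∀ (J : Set) (g : Ω → J) → Refines X g f → ¬ IsNodeSplitting X J g)
    × ¬ HasSingletonSector X f

  NodeSplittingsEquinumerous : Subset Ω → Set₁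
  NodeSplittingsEquinumerous X =
    ∀ (I J : Set) (f : Ω → I) (g : Ω → J) →
      IsNodeSplitting X I f → IsNodeSplitting X J g → I ↔ J

  module _ (P : Ω → Bool) where

    InP OutP : Subset Ω
    InP x = P x ≡ true
    OutP x = P x ≡ false

    Whole : Subset Ω
    Whole _ = ⊤

    IsAutomorphism : (Ω ↔ Ω) → Set
    IsAutomorphism σ =
      (∀ w x y z → D w x y z ⇔ D (to w) (to x) (to y) (to z))
      × (∀ x → P (to x) ≡ P x)
      where open Function.Bundles.Inverse σ

    -- Finite substructures A, B are given by injective enumerations
    -- a, b : Fin n → Ω; the isomorphism A → B is a i ↦ b i.
    PHomogeneous : Set
    PHomogeneous =
      ∀ (n : ℕ) (a b : Fin n → Ω) →
        Injective _≡_ _≡_ a → Injective _≡_ _≡_ b →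
        (Σ (Fin n) λ i → P (a i) ≡ true) →
        (Σ (Fin n) λ i → P (a i) ≡ false) →
        (Σ (Fin n) λ i → P (b i) ≡ true) →
        (Σ (Fin n) λ i → P (b i) ≡ false) →
        (∀ i j k l → D (a i) (a j) (a k) (a l) ⇔ D (b i) (b j) (b k) (b l)) →
        (∀ i → P (b i) ≡ P (a i)) →
        Σ (Ω ↔ Ω) λ σ → IsAutomorphism σ ×
          (∀ i → Function.Bundles.Inverse.to σ (a i) ≡ b i)

    InfiniteSectorsMeetBoth : Set₁
    InfiniteSectorsMeetBoth =
      ∀ (I : Set) (f : Ω → I) → IsSplitting Whole I f → ∀ (i : I) →
        Infinite (λ x → f x ≡ i) →
        (Σ Ω λ x → f x ≡ i × P x ≡ true) × (Σ Ω λ x → f x ≡ i × P x ≡ false)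

    PartitionIsTrueEdge : Set₁
    PartitionIsTrueEdge = IsTrueEdgeSplitting Whole Bool P

    ExactlyOne : Bool → Set
    ExactlyOne v = Σ Ω λ x → P x ≡ v × (∀ y → P y ≡ v → y ≡ x)

{-# OPTIONS --safe #-}
module Submission where

-- A D-set is the set of leaves of a tree: three distinct points span a node,
-- and the sectors at that node are the classes of an equivalence relation
-- definable from D.
--
-- Sufficiency is a back-and-forth argument. A new point x over a finite set A
-- is alone in its sector at some node spanned in A ∪ {x}, and the induced
-- equivalence relation on A determines the type of x. If the node is spanned
-- by A, equality of the numbers of sectors leaves a free sector at the image
-- node; if it is interior to an edge of the tree of A, density provides a
-- point on the image edge. Condition (3) makes every sector at a node meet the
-- majority colour of any three points spanning the node, and lets one choose
-- the new point of the right colour.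
--
-- Necessity uses that any two triples with the same colours are isomorphic,
-- as are any two quadruples with D(ab;cd) and the same colours. If nothing
-- lies between ab and cd, points can be exchanged until such a quadruple is
-- isomorphic to one which does have a point in between, so Ω is dense. If an
-- infinite sector has one colour, moving triples into it shows that the two
-- colours split Ω along an edge.

open import Defs
open import Level using (Lift; lift; lower) renaming (suc to lsuc; zero to lzero)
open import Axiom.ExcludedMiddle using (ExcludedMiddle)
open import Data.Bool using (Bool; true; false; not)
open import Data.Bool.Properties using (¬-not; not-¬)
open import Data.Empty using (⊥; ⊥-elim)
open import Data.Fin using (Fin; toℕ) renaming (zero to fzero; suc to fsuc)
open import Data.Fin.Properties using (pigeonhole)
open import Data.List using (List; []; _∷_; map; length; lookup; tabulate)
open import Data.List.Membership.Propositional using (_∈_)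
open import Data.List.Membership.Propositional.Properties using (∈-map⁺; ∈-map⁻; ∈-lookup; ∈-tabulate⁺; ∈-tabulate⁻)
open import Data.List.Relation.Unary.All as All using (All; []; _∷_)
open import Data.List.Relation.Unary.AllPairs using (AllPairs; []; _∷_)
open import Data.List.Relation.Unary.Any using (here; there; index)
open import Data.List.Relation.Unary.Any.Properties using (lookup-index)
open import Data.Nat using (ℕ; zero; suc; _≤_; _<_; _⊔_; _≤′_; ≤′-refl; ≤′-step)
open import Data.Nat.Induction using (<-rec)
open import Data.Nat.Properties using (≤-antisym; ≮⇒≥; ≤⇒≤′; m≤m⊔n; m≤n⊔m; n<1+n; <-irrefl)
open import Data.Product using (Σ; _×_; _,_; proj₁; proj₂; swap)
open import Data.Sum using (_⊎_; inj₁; inj₂; [_,_]′)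
open import Data.Unit using (⊤; tt)
open import Function.Bundles using (_⇔_; _↔_; mk⇔; mk↔ₛ′; Inverse; Equivalence)
open import Relation.Nullary using (¬_; Dec; yes; no)
open import Relation.Nullary.Decidable using (⌊_⌋; map′)
open import Relation.Binary.PropositionalEquality using (_≡_; _≢_; refl; sym; trans; cong; subst; ≢-sym)

-- Finite minima, infinite orbits and infinite sets

module Finite (dec : (A : Set) → Dec A) where

  -- Applied to branches leaving a fixed path, this picks one that leaves first or last, according
  -- to the direction of the order. The order is only partial, so `m` need not lie below the rest.
  minimal : {A : Set} (_≺_ : A → A → Set) →
    (∀ {x y z} → x ≺ y → y ≺ z → x ≺ z) → (∀ {x} → ¬ x ≺ x) →
    (Q : A → Set) (m₀ : A) → Q m₀ → (xs : List A) →
    Σ A λ m → Q m × (m ≡ m₀ ⊎ m ∈ xs) × (∀ y → y ∈ xs → Q y → ¬ y ≺ m)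
  minimal _≺_ tr irr Q m₀ q₀ [] = m₀ , q₀ , inj₁ refl , λ _ ()
  minimal _≺_ tr irr Q m₀ q₀ (x ∷ xs)
    with minimal _≺_ tr irr Q m₀ q₀ xs
  ... | m , qm , pos , low with dec (Q x × x ≺ m)
  ...   | yes (qx , x≺m) = x , qx , inj₂ (here refl) , λ where
            y (here refl) _  → irr
            y (there y∈)  qy y≺x → low y y∈ qy (tr y≺x x≺m)
  ...   | no ¬x = m , qm , [ inj₁ , (λ i → inj₂ (there i)) ]′ pos , λ where
            y (here refl) qy y≺m → ¬x (qy , y≺m)
            y (there y∈)  qy → low y y∈ qy

  least : (Q : ℕ → Set) → ∀ n → Q n → Σ ℕ λ m → Q m × (∀ k → Q k → m ≤ k)
  least Q = <-rec _ λ n rec qn → go n qn (λ {m} → rec {m}) (dec (Σ ℕ λ m → m < n × Q m))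
    where
    go : ∀ n → Q n → (∀ {m} → m < n → Q m → Σ ℕ λ m → Q m × (∀ k → Q k → m ≤ k)) →
         Dec (Σ ℕ λ m → m < n × Q m) → Σ ℕ λ m → Q m × (∀ k → Q k → m ≤ k)
    go n qn rec (yes (m , m<n , qm)) = rec m<n qm
    go n qn rec (no none) = n , qn , λ k qk → ≮⇒≥ λ k<n → none (k , k<n , qk)

  -- Cancelling equal numbers of applications of `F` reduces any repetition in the orbit of `i₀` to
  -- a return to `i₀`, which lies outside the image.
  escaping-orbit : {I : Set} (F : I → I) (i₀ : I) →
    (∀ {i j} → F i ≡ F j → i ≡ j) → (∀ i → F i ≢ i₀) →
    Σ (ℕ → I) λ o → ∀ m n → o m ≡ o n → m ≡ n
  escaping-orbit {I} F i₀ inj miss = o , o-inj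
    where
    o : ℕ → I
    o zero = i₀
    o (suc n) = F (o n)
    o-inj : ∀ m n → o m ≡ o n → m ≡ n
    o-inj zero zero _ = refl
    o-inj zero (suc n) e = ⊥-elim (miss _ (sym e))
    o-inj (suc m) zero e = ⊥-elim (miss _ e)
    o-inj (suc m) (suc n) e = cong suc (o-inj m n (inj e))

  infinite⇒two : {Ω : Set} {S : Subset Ω} → Infinite S → Σ Ω λ x → Σ Ω λ y → S x × S y × x ≢ y
  infinite⇒two {Ω} {S} inf with dec (Σ Ω S)
  ... | no none = ⊥-elim (inf ([] , λ x Sx → ⊥-elim (none (x , Sx))))
  ... | yes (x , Sx) with dec (Σ Ω λ y → S y × x ≢ y)
  ...   | yes (y , Sy , n) = x , y , Sx , Sy , n
  ...   | no none = ⊥-elim (inf (x ∷ [] , λ y Sy → here (only y Sy)))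
    where
    only : ∀ y → S y → y ≡ x
    only y Sy with dec (y ≡ x)
    ... | yes e = e
    ... | no n = ⊥-elim (none (y , Sy , ≢-sym n))

-- Elementary consequences of the axioms

module DSetTheory {Ω : Set} {D : Ω → Ω → Ω → Ω → Set} (isD : IsDSet D) (dec : (A : Set) → Dec A) where

  open IsDSet isD
  open Finite dec

  swapS : ∀ {w x y z} → D w x y z → D y z w x
  swapS d = proj₂ (D1 _ _ _ _ d)

  swapL : ∀ {w x y z} → D w x y z → D x w y z
  swapL d = proj₁ (D1 _ _ _ _ d)

  swapR : ∀ {w x y z} → D w x y z → D w x z y
  swapR d = swapS (swapL (swapS d))

  ≢₂₃ : ∀ {w x y z} → D w x y z → x ≢ y
  ≢₂₃ d refl = D2 _ _ _ _ d d

  ≢₁₃ : ∀ {w x y z} → D w x y z → w ≢ y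
  ≢₁₃ d = ≢₂₃ (swapL d)

  ≢₂₄ : ∀ {w x y z} → D w x y z → x ≢ z
  ≢₂₄ d = ≢₂₃ (swapR d)

  ≢₁₄ : ∀ {w x y z} → D w x y z → w ≢ z
  ≢₁₄ d = ≢₁₃ (swapR d)

  excl : ∀ {w x y z} → D w x y z → ¬ D w y x z
  excl = D2 _ _ _ _

  excl′ : ∀ {w x y z} → D w x y z → ¬ D w z x y
  excl′ d = excl (swapR d)

  point : ∀ {x a b} → x ≢ a → x ≢ b → D x x a b
  point x≢a x≢b = swapS (D4 _ _ _ (≢-sym x≢a) (≢-sym x≢b))

  -- If D3 gives the unwanted alternative both times, it yields `D y x a z` and `D y z a x`, which
  -- D2 makes incompatible.
  join : ∀ {x y z a b} → D x y a b → D y z a b → D x z a b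
  join {x} {y} {z} d e with D3 _ _ _ _ (swapL d) z
  ... | inj₁ f = swapL f
  ... | inj₂ f with D3 _ _ _ _ e x
  ...   | inj₁ g = g
  ...   | inj₂ g = ⊥-elim (excl (swapR f) (swapR g))

  joinR : ∀ {x y a b c} → D x y a b → D x y b c → D x y a c
  joinR d e = swapS (join (swapS d) (swapS e))

  -- D3 places `p` on one side of the edge between `xy` and `ab`; transitivity supplies the second
  -- relation on that side. This is the basic case distinction for locating a point.
  split : ∀ {x y a b} → D x y a b → ∀ p →
    (D x y a p × D x y b p) ⊎ (D x p a b × D y p a b)
  split d p with D3 _ _ _ _ d p
  ... | inj₂ e = inj₁ (e , joinR (swapR d) e)
  ... | inj₁ e = inj₂ (join d (swapL e) , swapL e)

  -- `D s m y u` says that, on the path from `s` to `u`, the branch to `y` leaves after the branch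
  -- to `m`. This is transitivity of that strict order.
  far-trans : ∀ {s u m y z} → D s m y u → D s y z u → D s m z u
  far-trans {z = z} d e with split d z
  ... | inj₁ (_ , f) = swapR f
  ... | inj₂ (f , _) = ⊥-elim (excl e f)

  -- Nodes as equivalence relations

  -- A node is encoded by the relation "in the same sector". The field `four` is the form of
  -- condition (ii) of splittings that assumes nothing about which sectors coincide. The number of
  -- sectors is left open; `Apart` supplies three.
  record IsNode (_~_ : Ω → Ω → Set) : Set where
    field
      ~-refl  : ∀ {x} → x ~ x
      ~-sym   : ∀ {x y} → x ~ y → y ~ x
      ~-trans : ∀ {x y z} → x ~ y → y ~ z → x ~ z
      sector  : ∀ {x y z w} → x ~ y → ¬ (x ~ z) → ¬ (x ~ w) → D x y z w
      four    : ∀ {x y z w} → D x y z w → x ~ y ⊎ z ~ w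

  record Apart (_~_ : Ω → Ω → Set) (a b c : Ω) : Set where
    constructor apart
    field
      ab : ¬ (a ~ b)
      ac : ¬ (a ~ c)
      bc : ¬ (b ~ c)

  Distinct : Ω → Ω → Ω → Set
  Distinct = Apart _≡_

  -- Two points lie in the same sector at the node spanned by a, b, c when
  -- they are separated from two of the three.
  Sim : Ω → Ω → Ω → Ω → Ω → Set
  Sim a b c x y = D x y a b ⊎ D x y a c ⊎ D x y b c

  -- The case of transitivity of `Sim` in which the two witnesses share only one reference point
  -- `s`.
  mix : ∀ {s t u x y z} → D x y s t → D y z s u → D x z s t ⊎ D x z s u
  mix {t = t} {u} d e with split d u
  ... | inj₁ (f , _) = inj₂ (join f e)
  ... | inj₂ (_ , f) with split e t
  ...   | inj₁ (g , _) = inj₁ (join d g)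
  ...   | inj₂ (g , _) = ⊥-elim (excl (swapR f) (swapR g))

  module _ {a b c : Ω} where

    Sim-sym : ∀ {x y} → Sim a b c x y → Sim a b c y x
    Sim-sym (inj₁ d) = inj₁ (swapL d)
    Sim-sym (inj₂ (inj₁ d)) = inj₂ (inj₁ (swapL d))
    Sim-sym (inj₂ (inj₂ d)) = inj₂ (inj₂ (swapL d))

    Sim-apart : Apart (Sim a b c) a b c
    Sim-apart = apart
      (λ { (inj₁ d) → ≢₁₃ d refl ; (inj₂ (inj₁ d)) → ≢₁₃ d refl ; (inj₂ (inj₂ d)) → ≢₂₃ d refl })
      (λ { (inj₁ d) → ≢₁₃ d refl ; (inj₂ (inj₁ d)) → ≢₁₃ d refl ; (inj₂ (inj₂ d)) → ≢₂₄ d refl })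
      (λ { (inj₁ d) → ≢₁₄ d refl ; (inj₂ (inj₁ d)) → ≢₂₄ d refl ; (inj₂ (inj₂ d)) → ≢₁₃ d refl })

    Sim-trans : ∀ {x y z} → Sim a b c x y → Sim a b c y z → Sim a b c x z
    Sim-trans (inj₁ d) (inj₁ e) = inj₁ (join d e)
    Sim-trans (inj₁ d) (inj₂ (inj₁ e)) with mix d e
    ... | inj₁ f = inj₁ f
    ... | inj₂ f = inj₂ (inj₁ f)
    Sim-trans (inj₁ d) (inj₂ (inj₂ e)) with mix (swapR d) e
    ... | inj₁ f = inj₁ (swapR f)
    ... | inj₂ f = inj₂ (inj₂ f)
    Sim-trans (inj₂ (inj₁ d)) (inj₁ e) with mix d e
    ... | inj₁ f = inj₂ (inj₁ f)
    ... | inj₂ f = inj₁ f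
    Sim-trans (inj₂ (inj₁ d)) (inj₂ (inj₁ e)) = inj₂ (inj₁ (join d e))
    Sim-trans (inj₂ (inj₁ d)) (inj₂ (inj₂ e)) with mix (swapR d) (swapR e)
    ... | inj₁ f = inj₂ (inj₁ (swapR f))
    ... | inj₂ f = inj₂ (inj₂ (swapR f))
    Sim-trans (inj₂ (inj₂ d)) (inj₁ e) with mix d (swapR e)
    ... | inj₁ f = inj₂ (inj₂ f)
    ... | inj₂ f = inj₁ (swapR f)
    Sim-trans (inj₂ (inj₂ d)) (inj₂ (inj₁ e)) with mix (swapR d) (swapR e)
    ... | inj₁ f = inj₂ (inj₂ (swapR f))
    ... | inj₂ f = inj₂ (inj₁ (swapR f))
    Sim-trans (inj₂ (inj₂ d)) (inj₂ (inj₂ e)) = inj₂ (inj₂ (join d e))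

    -- A point on the side of `x` in the relation that witnesses `Sim a b c x y` would itself be
    -- similar to `x`, so `z` and `w` both lie on the opposite side.
    Sim-sector : ∀ {x y z w} → Sim a b c x y → ¬ Sim a b c x z → ¬ Sim a b c x w → D x y z w
    Sim-sector {x} {y} {z} {w} s ¬z ¬w = go s
      where
      via : ∀ {s t} → (∀ {v} → D x v s t → Sim a b c x v) → D x y s t → D x y z w
      via sim d with split d z | split d w
      ... | inj₂ (e , _) | _ = ⊥-elim (¬z (sim e))
      ... | _ | inj₂ (e , _) = ⊥-elim (¬w (sim e))
      ... | inj₁ (e , _) | inj₁ (f , _) = joinR (swapR e) f
      go : Sim a b c x y → D x y z w
      go (inj₁ d) = via inj₁ d
      go (inj₂ (inj₁ d)) = via (λ e → inj₂ (inj₁ e)) d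
      go (inj₂ (inj₂ d)) = via (λ e → inj₂ (inj₂ e)) d

    -- Each of a, b, c lies on one side of the edge xy|zw, so two of them lie
    -- on the same side.
    Sim-four : ∀ {x y z w} → D x y z w → Sim a b c x y ⊎ Sim a b c z w
    Sim-four d with split d a | split d b | split d c
    ... | inj₁ (e , _) | inj₁ (f , _) | _ = inj₁ (inj₁ (joinR (swapR e) f))
    ... | inj₁ (e , _) | inj₂ _ | inj₁ (f , _) = inj₁ (inj₂ (inj₁ (joinR (swapR e) f)))
    ... | inj₂ _ | inj₁ (e , _) | inj₁ (f , _) = inj₁ (inj₂ (inj₂ (joinR (swapR e) f)))
    ... | inj₂ (e , _) | inj₂ (f , _) | _ = inj₂ (inj₁ (swapS (join (swapL e) f)))
    ... | inj₂ (e , _) | inj₁ _ | inj₂ (f , _) = inj₂ (inj₂ (inj₁ (swapS (join (swapL e) f))))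
    ... | inj₁ _ | inj₂ (e , _) | inj₂ (f , _) = inj₂ (inj₂ (inj₂ (swapS (join (swapL e) f))))

    Sim-refl : Distinct a b c → ∀ {x} → Sim a b c x x
    Sim-refl (apart a≢b a≢c b≢c) {x} with dec (x ≡ a) | dec (x ≡ b)
    ... | yes refl | _ = inj₂ (inj₂ (point a≢b a≢c))
    ... | no _ | yes refl = inj₂ (inj₁ (point (≢-sym a≢b) b≢c))
    ... | no x≢a | no x≢b = inj₁ (point x≢a x≢b)

    Sim-node : Distinct a b c → IsNode (Sim a b c)
    Sim-node dist = record
      { ~-refl = Sim-refl dist ; ~-sym = Sim-sym ; ~-trans = Sim-trans
      ; sector = Sim-sector ; four = Sim-four }

  module NodeProperties {_~_ : Ω → Ω → Set} (node : IsNode _~_) where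
    open IsNode node public

    ≁-sym : ∀ {x y} → ¬ (x ~ y) → ¬ (y ~ x)
    ≁-sym n e = n (~-sym e)

    ≁⇒≢ : ∀ {x y} → ¬ (x ~ y) → x ≢ y
    ≁⇒≢ n refl = n ~-refl

    Apart⇒Distinct : ∀ {a b c} → Apart _~_ a b c → Distinct a b c
    Apart⇒Distinct (apart ab ac bc) = apart (≁⇒≢ ab) (≁⇒≢ ac) (≁⇒≢ bc)

    two-others : ∀ {a b c} → Apart _~_ a b c → ∀ s →
      Σ Ω λ u → Σ Ω λ v → ¬ (s ~ u) × ¬ (s ~ v) × ¬ (u ~ v)
    two-others {a} {b} {c} (apart ab ac bc) s with dec (s ~ a) | dec (s ~ b)
    ... | yes p | _ = b , c , (λ q → ab (~-trans (~-sym p) q)) , (λ q → ac (~-trans (~-sym p) q)) , bc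
    ... | no ¬p | yes q = a , c , ¬p , (λ r → bc (~-trans (~-sym q) r)) , ac
    ... | no ¬p | no ¬q = a , b , ¬p , ¬q , ab

    -- Two reference points are never in one sector, so `four` leaves only `x ~ y`. A point alone
    -- for `~` is therefore alone at the node spanned by any three points in different sectors.
    Sim⇒~ : ∀ {a b c} → Apart _~_ a b c → ∀ {x y} → Sim a b c x y → x ~ y
    Sim⇒~ (apart ab ac bc) (inj₁ d) = [ (λ e → e) , (λ e → ⊥-elim (ab e)) ]′ (four d)
    Sim⇒~ (apart ab ac bc) (inj₂ (inj₁ d)) = [ (λ e → e) , (λ e → ⊥-elim (ac e)) ]′ (four d)
    Sim⇒~ (apart ab ac bc) (inj₂ (inj₂ d)) = [ (λ e → e) , (λ e → ⊥-elim (bc e)) ]′ (four d)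

    -- Hence the D-type of a point x alone in its sector is determined by ~ and
    -- by D on the other points.
    replace-by : ∀ {x t e f g} → f ~ g → ¬ (x ~ f) → ¬ (t ~ f) → D x e f g → D t e f g
    replace-by f~g x≁f t≁f d =
      swapL (join (swapL d) (swapS (sector f~g (≁-sym x≁f) (≁-sym t≁f))))

    -- A finite list covering the sector would have a member `m` such that no listed branch within
    -- the sector leaves the path from `s` towards `u` later. Density inserts `t` between `sm` and
    -- `uv`: it is still in the sector, and it leaves later.
    sector-infinite : IsDense D → ∀ {a b c} → Apart _~_ a b c → ∀ s → Infinite (λ y → y ~ s)
    sector-infinite (_ , dense) ap s (xs , covers) with two-others ap s
    ... | u , v , s≁u , s≁v , u≁v
      with minimal (λ y m → D s m y u) (λ zy ym → far-trans ym zy) (λ d → ≢₂₃ d refl)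
             (λ m → s ~ m) s ~-refl xs
    ...   | m , s~m , _ , low with dense _ _ _ _ (sector s~m s≁u s≁v)
    ...     | t , _ , d₂ , _ , d₄ with four d₂
    ...       | inj₂ u~v = u≁v u~v
    ...       | inj₁ s~t = low t (covers t (~-sym s~t)) s~t (swapR d₄)

    -- The splitting given by a node

    module Labelling (c : Ω → ℕ) (c-inj : ∀ {x y} → c x ≡ c y → x ≡ y) where

      rep : ∀ x → Σ Ω λ r → (r ~ x) × (∀ y → y ~ x → c r ≤ c y)
      rep x with least (λ n → Σ Ω λ y → y ~ x × c y ≡ n) (c x) (x , ~-refl , refl)
      ... | n , (r , r~x , refl) , low = r , r~x , λ y y~x → low _ (y , y~x , refl)

      rep-cong : ∀ {x y} → x ~ y → proj₁ (rep x) ≡ proj₁ (rep y)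
      rep-cong {x} {y} x~y with rep x | rep y
      ... | r , r~x , low | r′ , r′~y , low′ =
        c-inj (≤-antisym (low r′ (~-trans r′~y (~-sym x~y))) (low′ r (~-trans r~x x~y)))

      -- The quotient by ~, realised by the points of least index.
      Sector : Set
      Sector = Σ Ω λ r → proj₁ (rep r) ≡ r

      label : Ω → Sector
      label x = proj₁ (rep x) , rep-cong (proj₁ (proj₂ (rep x)))

      Sector-≡ : {s t : Sector} → proj₁ s ≡ proj₁ t → s ≡ t
      Sector-≡ {_ , p} {_ , q} refl = cong (_ ,_) (uip p q)
        where
        uip : {x y : Ω} (p q : x ≡ y) → p ≡ q
        uip refl refl = refl

      label-cong : ∀ {x y} → x ~ y → label x ≡ label y
      label-cong x~y = Sector-≡ (rep-cong x~y)

      label-injective : ∀ {x y} → label x ≡ label y → x ~ y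
      label-injective {x} {y} e =
        ~-trans (~-sym (proj₁ (proj₂ (rep x))))
          (subst (_~ y) (sym (cong proj₁ e)) (proj₁ (proj₂ (rep y))))

      label-onto : ∀ i → label (proj₁ i) ≡ i
      label-onto (_ , p) = Sector-≡ p

      -- As `X` meets every sector of the node, the labels of the splitting induced on `X` are all
      -- the sectors in Ω. Counting sectors of a colour class thus counts sectors of the node.
      label-splitting : {X : Subset Ω} → (∀ x → Σ Ω λ y → X y × y ~ x) →
        ∀ {a b c} → Apart _~_ a b c → IsNodeSplitting D X Sector label
      label-splitting {X} meets {a} {b} {c} (apart ab ac bc) = record
          { onto = λ i → proj₁ (meets (proj₁ i)) , proj₁ (proj₂ (meets (proj₁ i)))
                       , trans (label-cong (proj₂ (proj₂ (meets (proj₁ i))))) (label-onto i)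
          ; twoParts = three .proj₁ , three .proj₂ .proj₁
                     , three .proj₂ .proj₂ .proj₂ .proj₁
                     , three .proj₂ .proj₂ .proj₂ .proj₂ .proj₁
                     , three .proj₂ .proj₂ .proj₂ .proj₂ .proj₂ .proj₂ .proj₁
          ; sectorCond = λ _ _ _ _ _ _ _ _ p q r → sector (label-injective p)
              (λ e → q (sym (label-cong e))) (λ e → r (sym (label-cong e)))
          ; fourCond = λ _ _ _ _ _ _ _ _ p _ _ _ _ q d →
              [ (λ e → p (label-cong e)) , (λ e → q (label-cong e)) ]′ (four d)
          } , three
        where
        far : ∀ {x y} → ¬ (x ~ y) → label (proj₁ (meets x)) ≢ label (proj₁ (meets y))
        far x≁y e = x≁y (~-trans (~-sym (proj₂ (proj₂ (meets _))))
                          (~-trans (label-injective e) (proj₂ (proj₂ (meets _)))))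
        three : MoreThanTwo D X label
        three = _ , _ , _ , proj₁ (proj₂ (meets a)) , proj₁ (proj₂ (meets b))
              , proj₁ (proj₂ (meets c)) , far ab , far ac , far bc

  -- From splittings back to nodes

  module SplittingProperties {X : Subset Ω} {I : Set} {f : Ω → I} (spl : IsSplitting D X I f) where
    open IsSplitting spl

    -- If neither pair shares a sector, any coincidence across the pairs gives by `sectorCond` a
    -- relation that D2 forbids, and without coincidences `fourCond` applies.
    fourStrong : ∀ {a b c d} → X a → X b → X c → X d → D a b c d → f a ≡ f b ⊎ f c ≡ f d
    fourStrong {a} {b} {c} {d} xa xb xc xd δ
      with dec (f a ≡ f b) | dec (f c ≡ f d)
    ... | yes e | _ = inj₁ e
    ... | no _ | yes e = inj₂ e
    ... | no ab | no cd
      with dec (f a ≡ f c) | dec (f a ≡ f d) | dec (f b ≡ f c) | dec (f b ≡ f d)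
    ... | yes e | _ | _ | _ = ⊥-elim (excl δ
            (sectorCond _ _ _ _ xa xc xb xd e (≢-sym ab) (λ q → cd (sym (trans q e)))))
    ... | no _ | yes e | _ | _ = ⊥-elim (excl′ δ
            (sectorCond _ _ _ _ xa xd xb xc e (≢-sym ab) (λ q → cd (trans q e))))
    ... | no _ | no _ | yes e | _ = ⊥-elim (excl (swapL δ)
            (sectorCond _ _ _ _ xb xc xa xd e ab (λ q → cd (sym (trans q e)))))
    ... | no _ | no _ | no _ | yes e = ⊥-elim (excl′ (swapL δ)
            (sectorCond _ _ _ _ xb xd xa xc e ab (λ q → cd (trans q e))))
    ... | no ac | no ad | no bc | no bd =
            ⊥-elim (fourCond _ _ _ _ xa xb xc xd ab ac ad bc bd cd δ)

    module _ {a b c : Ω} (xa : X a) (xb : X b) (xc : X c) (ap : Apart (λ x y → f x ≡ f y) a b c) where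
      open Apart ap

      -- At most one of `a`, `b`, `c` is in the sector of `x`; the other two witness `Sim`. With the
      -- converse below, three points of `X` in different sectors determine the splitting of `X`.
      ≡⇒Sim : ∀ {x y} → X x → X y → f x ≡ f y → Sim a b c x y
      ≡⇒Sim {x} {y} xx xy e with dec (f a ≡ f x) | dec (f b ≡ f x)
      ... | yes p | _ = inj₂ (inj₂ (sectorCond _ _ _ _ xx xy xb xc e
                          (λ q → ab (trans p (sym q))) (λ q → ac (trans p (sym q)))))
      ... | no ¬p | yes p = inj₂ (inj₁ (sectorCond _ _ _ _ xx xy xa xc e
                          ¬p (λ q → bc (trans p (sym q)))))
      ... | no ¬p | no ¬q = inj₁ (sectorCond _ _ _ _ xx xy xa xb e ¬p ¬q)

      Sim⇒≡ : ∀ {x y} → X x → X y → Sim a b c x y → f x ≡ f y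
      Sim⇒≡ xx xy (inj₁ d) = [ (λ e → e) , (λ e → ⊥-elim (ab e)) ]′ (fourStrong xx xy xa xb d)
      Sim⇒≡ xx xy (inj₂ (inj₁ d)) = [ (λ e → e) , (λ e → ⊥-elim (ac e)) ]′ (fourStrong xx xy xa xc d)
      Sim⇒≡ xx xy (inj₂ (inj₂ d)) = [ (λ e → e) , (λ e → ⊥-elim (bc e)) ]′ (fourStrong xx xy xb xc d)

  -- Finite partial isomorphisms

  module Coloured (P : Ω → Bool) (c : Ω → ℕ) (c-inj : ∀ {x y} → c x ≡ c y → x ≡ y) where

    Colour : Bool → Subset Ω
    Colour k x = P x ≡ k

    Partial : Set
    Partial = List (Ω × Ω)

    -- The projections are parameters so that each lemma serves both directions of a partial
    -- isomorphism.
    Preserves : (π π′ : Ω × Ω → Ω) → Partial → Set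
    Preserves π π′ L = ∀ {p q r s} → p ∈ L → q ∈ L → r ∈ L → s ∈ L →
      D (π p) (π q) (π r) (π s) → D (π′ p) (π′ q) (π′ r) (π′ s)

    record PartialIso (L : Partial) : Set where
      field
        forth  : Preserves proj₁ proj₂ L
        back   : Preserves proj₂ proj₁ L
        colour : ∀ {p} → p ∈ L → P (proj₁ p) ≡ P (proj₂ p)

    open PartialIso

    PartialIso-⊆ : ∀ {L L′} → (∀ {p} → p ∈ L′ → p ∈ L) → PartialIso L → PartialIso L′
    PartialIso-⊆ sub iso = record
      { forth = λ p q r s → forth iso (sub p) (sub q) (sub r) (sub s)
      ; back = λ p q r s → back iso (sub p) (sub q) (sub r) (sub s)
      ; colour = λ p → colour iso (sub p) }

    ∈-swap⁻ : ∀ {L : Partial} {p} → p ∈ map swap L → swap p ∈ L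
    ∈-swap⁻ p∈ with ∈-map⁻ swap p∈
    ... | _ , q∈ , refl = q∈

    PartialIso-swap : ∀ {L} → PartialIso L → PartialIso (map swap L)
    PartialIso-swap iso = record
      { forth = λ p q r s → back iso (∈-swap⁻ p) (∈-swap⁻ q) (∈-swap⁻ r) (∈-swap⁻ s)
      ; back = λ p q r s → forth iso (∈-swap⁻ p) (∈-swap⁻ q) (∈-swap⁻ r) (∈-swap⁻ s)
      ; colour = λ p → sym (colour iso (∈-swap⁻ p)) }

    -- Equality is visible to `D`: distinct points satisfy `D p p q q`, which fails once the images
    -- coincide.
    Preserves-≡ : ∀ {π π′ L} → Preserves π π′ L → ∀ {p q} → p ∈ L → q ∈ L →
      π′ p ≡ π′ q → π p ≡ π q
    Preserves-≡ {π} {π′} pres {p} {q} p∈ q∈ e with dec (π p ≡ π q)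
    ... | yes e′ = e′
    ... | no ne = ⊥-elim (≢₁₃ (pres p∈ p∈ q∈ q∈ (point ne ne)) e)

    -- The symmetries D1 move a single occurrence of the new point to the first place. Two
    -- occurrences on one side give a degenerate relation that holds by freshness; occurrences on
    -- opposite sides are impossible.
    Preserves-∷ : ∀ {π π′ L z} → Preserves π π′ L →
      (∀ {q} → q ∈ L → π′ z ≢ π′ q) →
      (∀ {q r s} → q ∈ L → r ∈ L → s ∈ L →
        D (π z) (π q) (π r) (π s) → D (π′ z) (π′ q) (π′ r) (π′ s)) →
      Preserves π π′ (z ∷ L)
    Preserves-∷ pres ne ext = λ where
      (there p) (there q) (there r) (there s) d → pres p q r s d
      (here refl) (there q) (there r) (there s) d → ext q r s d
      (there p) (here refl) (there r) (there s) d → swapL (ext p r s (swapL d))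
      (there p) (there q) (here refl) (there s) d → swapS (ext s p q (swapS d))
      (there p) (there q) (there r) (here refl) d → swapS (swapL (ext r p q (swapL (swapS d))))
      (here refl) (here refl) (there r) (there s) d → point (ne r) (ne s)
      (there p) (there q) (here refl) (here refl) d → swapS (point (ne p) (ne q))
      (here refl) _ (here refl) _ d → ⊥-elim (≢₁₃ d refl)
      (here refl) _ _ (here refl) d → ⊥-elim (≢₁₄ d refl)
      _ (here refl) (here refl) _ d → ⊥-elim (≢₂₃ d refl)
      _ (here refl) _ (here refl) d → ⊥-elim (≢₂₄ d refl)

    -- Since `π z` is alone, a relation `D (π z) (π q) (π r) (π s)` puts `r` and `s` in one sector.
    -- An old point outside that sector may replace `z` before the relation is carried over, and `z`
    -- may then replace it again; `u` or `v` is such a point.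
    Preserves-extend : ∀ {_~_ _≈_ : Ω → Ω → Set} → IsNode _~_ → IsNode _≈_ →
      ∀ {π π′ L z} → Preserves π π′ L →
      (∀ {p} → p ∈ L → ¬ (π z ~ π p)) → (∀ {p} → p ∈ L → ¬ (π′ z ≈ π′ p)) →
      (∀ {p q} → p ∈ L → q ∈ L → π p ~ π q → π′ p ≈ π′ q) →
      (∀ {p q} → p ∈ L → q ∈ L → π′ p ≈ π′ q → π p ~ π q) →
      ∀ {u v} → u ∈ L → v ∈ L → ¬ (π u ~ π v) →
      Preserves π π′ (z ∷ L)
    Preserves-extend {_~_} {_≈_} node node′ {π} {π′} {L} {z} pres al al′ to from {u} {v} u∈ v∈ u≁v =
      Preserves-∷ pres (λ q → N′.≁⇒≢ (al′ q)) ext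
      where
      module N = NodeProperties node
      module N′ = NodeProperties node′
      outside : ∀ {r} → r ∈ L → Σ (Ω × Ω) λ t → t ∈ L × ¬ (π t ~ π r)
      outside {r} r∈ with dec (π u ~ π r)
      ... | no n = u , u∈ , n
      ... | yes e = v , v∈ , λ e′ → u≁v (N.~-trans e (N.~-sym e′))
      ext : ∀ {q r s} → q ∈ L → r ∈ L → s ∈ L →
        D (π z) (π q) (π r) (π s) → D (π′ z) (π′ q) (π′ r) (π′ s)
      ext q r s d with N.four d | outside r
      ... | inj₁ e | _ = ⊥-elim (al q e)
      ... | inj₂ r~s | t , t∈ , t≁r =
        N′.replace-by (to r s r~s) (λ e → t≁r (from t∈ r e)) (al′ r)
          (pres t∈ q r s (N.replace-by r~s (al r) t≁r d))

    extend : ∀ {_~_ _≈_ : Ω → Ω → Set} → IsNode _~_ → IsNode _≈_ →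
      ∀ {L x y} → PartialIso L →
      (∀ {p} → p ∈ L → ¬ (x ~ proj₁ p)) → (∀ {p} → p ∈ L → ¬ (y ≈ proj₂ p)) →
      (∀ {p q} → p ∈ L → q ∈ L → proj₁ p ~ proj₁ q → proj₂ p ≈ proj₂ q) →
      (∀ {p q} → p ∈ L → q ∈ L → proj₂ p ≈ proj₂ q → proj₁ p ~ proj₁ q) →
      ∀ {u v} → u ∈ L → v ∈ L → ¬ (proj₁ u ~ proj₁ v) →
      P x ≡ P y → PartialIso ((x , y) ∷ L)
    forth (extend node node′ iso al al′ to from u v n e) =
      Preserves-extend node node′ (forth iso) al al′ to from u v n
    back (extend node node′ iso al al′ to from u v n e) =
      Preserves-extend node′ node (back iso) al′ al from to u v (λ m → n (from u v m))
    colour (extend _ _ _ _ _ _ _ _ _ _ e) (here refl) = e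
    colour (extend _ _ iso _ _ _ _ _ _ _ _) (there p) = colour iso p

    PartialIso-pair : ∀ {a b a′ b′} → a ≢ b → a′ ≢ b′ → P a ≡ P a′ → P b ≡ P b′ →
      PartialIso ((a , a′) ∷ (b , b′) ∷ [])
    PartialIso-pair a≢b a′≢b′ ea eb = record
      { forth = Preserves-∷ (Preserves-∷ (λ ()) (λ ()) (λ ())) (λ { (here refl) → a′≢b′ ; (there ()) })
          (λ { (here refl) (here refl) _ d → ⊥-elim (≢₂₃ d refl) ; (there ()) ; (here refl) (there ()) })
      ; back = Preserves-∷ (Preserves-∷ (λ ()) (λ ()) (λ ())) (λ { (here refl) → a≢b ; (there ()) })
          (λ { (here refl) (here refl) _ d → ⊥-elim (≢₂₃ d refl) ; (there ()) ; (here refl) (there ()) })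
      ; colour = λ { (here refl) → ea ; (there (here refl)) → eb } }

    -- Each of three distinct points is alone at the node they span, so `extend` applies with no
    -- condition beyond the colours.
    PartialIso-triple : ∀ {a b c a′ b′ c′} → Distinct a b c → Distinct a′ b′ c′ →
      P a ≡ P a′ → P b ≡ P b′ → P c ≡ P c′ →
      PartialIso ((a , a′) ∷ (b , b′) ∷ (c , c′) ∷ [])
    PartialIso-triple {a} {b} {c} {a′} {b′} {c′} dist dist′ ea eb ec =
      extend (Sim-node dist) (Sim-node dist′)
        (PartialIso-pair (Apart.bc dist) (Apart.bc dist′) eb ec)
        (λ { (here refl) → A.ab ; (there (here refl)) → A.ac })
        (λ { (here refl) → A′.ab ; (there (here refl)) → A′.ac })
        (λ { (here refl) (here refl) _ → Sim-refl dist′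
           ; (there (here refl)) (there (here refl)) _ → Sim-refl dist′
           ; (here refl) (there (here refl)) e → ⊥-elim (A.bc e)
           ; (there (here refl)) (here refl) e → ⊥-elim (A.bc (Sim-sym e)) })
        (λ { (here refl) (here refl) _ → Sim-refl dist
           ; (there (here refl)) (there (here refl)) _ → Sim-refl dist
           ; (here refl) (there (here refl)) e → ⊥-elim (A′.bc e)
           ; (there (here refl)) (here refl) e → ⊥-elim (A′.bc (Sim-sym e)) })
        (here refl) (there (here refl)) A.bc ea
      where
      module A = Apart (Sim-apart {a} {b} {c})
      module A′ = Apart (Sim-apart {a′} {b′} {c′})

    -- At the node spanned by `a`, `b`, `c` the point `d` falls into the sector of `c`, and `a` is
    -- alone. The same partition arises on the right.
    PartialIso-quad : ∀ {a b c d a′ b′ c′ d′} →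
      D a b c d → D a′ b′ c′ d′ → a ≢ b → a′ ≢ b′ → c ≢ d → c′ ≢ d′ →
      P a ≡ P a′ → P b ≡ P b′ → P c ≡ P c′ → P d ≡ P d′ →
      PartialIso ((a , a′) ∷ (b , b′) ∷ (c , c′) ∷ (d , d′) ∷ [])
    PartialIso-quad {a} {b} {c} {d} {a′} {b′} {c′} {d′} δ δ′ a≢b a′≢b′ c≢d c′≢d′ ea eb ec ed =
      extend (Sim-node dist) (Sim-node dist′)
        (PartialIso-triple (apart (≢₂₃ δ) (≢₂₄ δ) c≢d) (apart (≢₂₃ δ′) (≢₂₄ δ′) c′≢d′) eb ec ed)
        (λ { (here refl) → A.ab ; (there (here refl)) → A.ac ; (there (there (here refl))) → ad δ })
        (λ { (here refl) → A′.ab ; (there (here refl)) → A′.ac ; (there (there (here refl))) → ad δ′ })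
        (same proj₁ proj₂ δ δ′ dist′) (same proj₂ proj₁ δ′ δ dist)
        (here refl) (there (here refl)) A.bc ea
      where
      module A = Apart (Sim-apart {a} {b} {c})
      module A′ = Apart (Sim-apart {a′} {b′} {c′})
      dist : Distinct a b c
      dist = apart a≢b (≢₁₃ δ) (≢₂₃ δ)
      dist′ : Distinct a′ b′ c′
      dist′ = apart a′≢b′ (≢₁₃ δ′) (≢₂₃ δ′)
      cd : ∀ {a b c d} → D a b c d → Sim a b c c d
      cd δ = inj₁ (swapS δ)
      ad : ∀ {a b c d} → D a b c d → ¬ Sim a b c a d
      ad δ e = Apart.ac Sim-apart (Sim-trans e (Sim-sym (cd δ)))
      bd : ∀ {a b c d} → D a b c d → ¬ Sim a b c b d
      bd δ e = Apart.bc Sim-apart (Sim-trans e (Sim-sym (cd δ)))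
      same : ∀ (π π′ : Ω × Ω → Ω) {x y z a a′} →
        D a (π x) (π y) (π z) → D a′ (π′ x) (π′ y) (π′ z) → Distinct a′ (π′ x) (π′ y) →
        ∀ {p q} → p ∈ (x ∷ y ∷ z ∷ []) → q ∈ (x ∷ y ∷ z ∷ []) →
        Sim a (π x) (π y) (π p) (π q) → Sim a′ (π′ x) (π′ y) (π′ p) (π′ q)
      same _ _ δ δ′ dist (here refl) (here refl) e = Sim-refl dist
      same _ _ δ δ′ dist (there (here refl)) (there (here refl)) e = Sim-refl dist
      same _ _ δ δ′ dist (there (there (here refl))) (there (there (here refl))) e = Sim-refl dist
      same _ _ δ δ′ dist (there (here refl)) (there (there (here refl))) e = cd δ′
      same _ _ δ δ′ dist (there (there (here refl))) (there (here refl)) e = Sim-sym (cd δ′)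
      same _ _ δ δ′ dist (here refl) (there (here refl)) e = ⊥-elim (Apart.bc Sim-apart e)
      same _ _ δ δ′ dist (there (here refl)) (here refl) e = ⊥-elim (Apart.bc Sim-apart (Sim-sym e))
      same _ _ δ δ′ dist (here refl) (there (there (here refl))) e = ⊥-elim (bd δ e)
      same _ _ δ δ′ dist (there (there (here refl))) (here refl) e = ⊥-elim (bd δ (Sim-sym e))

three-Bools : ∀ {x y z : Bool} → x ≢ y → x ≢ z → y ≢ z → ⊥
three-Bools {true} {true} xy xz yz = xy refl
three-Bools {true} {false} {true} xy xz yz = xz refl
three-Bools {true} {false} {false} xy xz yz = yz refl
three-Bools {false} {false} xy xz yz = xy refl
three-Bools {false} {true} {false} xy xz yz = xz refl
three-Bools {false} {true} {true} xy xz yz = yz refl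

-- Consequences of condition (3)

module Conditions {Ω : Set} {D : Ω → Ω → Ω → Ω → Set} (isD : IsDSet D) (dec : (A : Set) → Dec A)
  (P : Ω → Bool) (c : Ω → ℕ) (c-inj : ∀ {x y} → c x ≡ c y → x ≡ y) where

  open DSetTheory isD dec

  Trichotomy : Set₁
  Trichotomy = InfiniteSectorsMeetBoth D P ⊎ PartitionIsTrueEdge D P
             ⊎ (ExactlyOne D P true ⊎ ExactlyOne D P false)

  ExactlyOne-some : ExactlyOne D P true ⊎ ExactlyOne D P false → Σ Bool (ExactlyOne D P)
  ExactlyOne-some (inj₁ e) = true , e
  ExactlyOne-some (inj₂ e) = false , e

  edge-sector : PartitionIsTrueEdge D P → ∀ {k a b c d} →
    P a ≡ k → P b ≡ k → P c ≢ k → P d ≢ k → D a b c d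
  edge-sector ((spl , _) , _) refl e f g =
    IsSplitting.sectorCond spl _ _ _ _ tt tt tt tt (sym e) f g

  other-point : PartitionIsTrueEdge D P → ∀ {k x} → P x ≡ k → Σ Ω λ y → P y ≡ k × y ≢ x
  other-point (_ , _ , ¬sing) {k} {x} e with dec (Σ Ω λ y → P y ≡ k × y ≢ x)
  ... | yes r = r
  ... | no none = ⊥-elim (¬sing (x , tt , only))
    where
    only : ∀ y → ⊤ → P y ≡ P x → y ≡ x
    only y _ e′ with dec (y ≡ x)
    ... | yes q = q
    ... | no n = ⊥-elim (none (y , trans e′ e , n))

  module _ (dense : IsDense D) where

    -- The condition is applied to the edge splitting into the sector of s and
    -- its complement, so no quotient is needed.
    sectors-meet-both : InfiniteSectorsMeetBoth D P →
      ∀ {_~_} → IsNode _~_ → ∀ {a b c} → Apart _~_ a b c →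
      ∀ k s → Σ Ω λ y → P y ≡ k × y ~ s
    sectors-meet-both inf {_~_} node {a} {b} {c} ap k s = pick k
      where
      open NodeProperties node
      f : Ω → Bool
      f x = ⌊ dec (x ~ s) ⌋
      f-true : ∀ {x} → f x ≡ true → x ~ s
      f-true {x} e with dec (x ~ s)
      ... | yes p = p
      f-in : ∀ {x} → x ~ s → f x ≡ true
      f-in {x} p with dec (x ~ s)
      ... | yes _ = refl
      ... | no n = ⊥-elim (n p)
      f-out : ∀ {x} → ¬ (x ~ s) → f x ≡ false
      f-out {x} n with dec (x ~ s)
      ... | yes p = ⊥-elim (n p)
      ... | no _ = refl
      f-false : ∀ {x} → f x ≡ false → ¬ (x ~ s)
      f-false e p with trans (sym e) (f-in p)
      ... | ()
      u = proj₁ (two-others ap s)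
      fu : f u ≡ false
      fu = f-out (≁-sym (proj₁ (proj₂ (proj₂ (two-others ap s)))))
      fs : f s ≡ true
      fs = f-in ~-refl
      cond : ∀ {k} a b c d → f a ≡ k → f b ≡ k → f c ≡ not k → f d ≡ not k → D a b c d
      cond {true} a b c d pa pb pc pd = sector (~-trans (f-true pa) (~-sym (f-true pb)))
        (λ e → f-false pc (~-trans (~-sym e) (f-true pa)))
        (λ e → f-false pd (~-trans (~-sym e) (f-true pa)))
      cond {false} a b c d pa pb pc pd = swapS (cond {true} c d a b pc pd pa pb)
      spl : IsSplitting D (Whole D P) Bool f
      spl = record
        { onto = λ { true → s , tt , fs ; false → u , tt , fu }
        ; twoParts = s , u , tt , tt , λ e → not-¬ {false} refl (trans (sym fu) (trans (sym e) fs))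
        ; sectorCond = λ a b c d _ _ _ _ p q r → cond a b c d refl (sym p) (¬-not q) (¬-not r)
        ; fourCond = λ _ _ _ _ _ _ _ _ p q _ r _ _ _ → three-Bools p q r }
      both = inf Bool f spl true
        λ { (xs , cov) → sector-infinite dense ap s (xs , λ y y~s → cov y (f-in y~s)) }
      pick : ∀ k → Σ Ω λ y → P y ≡ k × y ~ s
      pick true with proj₁ both
      ... | y , e , p = y , p , f-true e
      pick false with proj₂ both
      ... | y , e , p = y , p , f-true e

    -- In case (b) a sector without colour `k` would contain the whole other colour, making the node
    -- a refinement of the true edge splitting. In case (c) the sector is infinite, and the repeated
    -- colour `k` cannot be that of the unique point.
    sectors-meet-majority : Trichotomy → ∀ {k a b z} → Distinct a b z → P a ≡ k → P b ≡ k →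
      ∀ x → Σ Ω λ y → P y ≡ k × Sim a b z y x
    sectors-meet-majority (inj₁ inf) dist _ _ x =
      sectors-meet-both inf (Sim-node dist) Sim-apart _ x
    sectors-meet-majority (inj₂ (inj₁ edge)) {k} {a} {b} {z} dist pa pb x
      with dec (Σ Ω λ y → P y ≡ k × Sim a b z y x)
    ... | yes r = r
    ... | no none = ⊥-elim (proj₁ (proj₂ edge) Sector label refines
            (label-splitting (λ y → y , tt , ~-refl) Sim-apart))
      where
      open NodeProperties (Sim-node dist)
      open Labelling c c-inj
      avoids : ∀ {y} → Sim a b z y x → P y ≢ k
      avoids s e = none (_ , e , s)
      all-in : ∀ {y} → P y ≢ k → Sim a b z y x
      -- Both `y` and `x` have the colour other than `k`, so the edge separates them from `a` and
      -- `b`.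
      all-in n = inj₁ (swapS (edge-sector edge pa pb n (avoids ~-refl)))
      refines : Refines D (Whole D P) label P
      refines u v _ _ e with dec (P u ≡ k) | dec (P v ≡ k)
      ... | yes p | yes q = trans p (sym q)
      ... | no p | no q = trans (¬-not p) (sym (¬-not q))
      ... | yes p | no q = ⊥-elim (avoids (~-trans (label-injective e) (all-in q)) p)
      ... | no p | yes q = ⊥-elim (avoids (~-trans (~-sym (label-injective e)) (all-in p)) q)
    sectors-meet-majority (inj₂ (inj₂ one)) {k} {a} {b} {z} dist pa pb x with ExactlyOne-some one
    ... | j , o , _ , only with dec (Σ Ω λ y → P y ≡ k × Sim a b z y x)
    ...   | yes r = r
    ...   | no none = ⊥-elim (sector-infinite dense Sim-apart x (o ∷ [] , λ y s → here (single y s)))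
      where
      open NodeProperties (Sim-node dist)
      single : ∀ y → Sim a b z y x → y ≡ o
      single y s with dec (P y ≡ j)
      ... | yes p = only y p
      ... | no p with dec (k ≡ j)
      ...   | yes refl = ⊥-elim (Apart.ab dist (trans (only a pa) (sym (only b pb))))
      ...   | no k≢j = ⊥-elim (none (y , trans (¬-not p) (sym (¬-not k≢j)) , s))

-- Sufficiency: adding one point

module Extension {Ω : Set} {D : Ω → Ω → Ω → Ω → Set} (isD : IsDSet D) (dec : (A : Set) → Dec A)
  (P : Ω → Bool) (c : Ω → ℕ) (c-inj : ∀ {x y} → c x ≡ c y → x ≡ y)
  (dense : IsDense D)
  (equinumerous : ∀ k → NodeSplittingsEquinumerous D (λ x → P x ≡ k))
  (trichotomy : InfiniteSectorsMeetBoth D P ⊎ PartitionIsTrueEdge D P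
              ⊎ (ExactlyOne D P true ⊎ ExactlyOne D P false)) where

  open IsDSet isD
  open Finite dec
  open DSetTheory isD dec
  open Coloured P c c-inj
  open PartialIso
  open Conditions isD dec P c c-inj

  Bichromatic : Partial → Set
  Bichromatic L = ∀ k → Σ (Ω × Ω) λ p → p ∈ L × P (proj₁ p) ≡ k

  module OnePoint {L : Partial} (iso : PartialIso L) (bi : Bichromatic L)
    (x : Ω) (new : ∀ {p} → p ∈ L → x ≢ proj₁ p) where

    private
      k : Bool
      k = P x

    colour′ : ∀ {p j} → p ∈ L → P (proj₁ p) ≡ j → P (proj₂ p) ≡ j
    colour′ p∈ e = trans (sym (colour iso p∈)) e

    -- As `L` has both colours, a one-element colour class already occurs in `L`, with the same
    -- point on both sides.
    same-point : ∀ {j} → ExactlyOne D P j → Σ (Ω × Ω) λ p → p ∈ L × (∀ y → P y ≡ j → y ≡ proj₁ p × y ≡ proj₂ p)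
    same-point {j} (o , _ , only) with bi j
    ... | p , p∈ , e = p , p∈ , λ y ey →
      trans (only y ey) (sym (only _ e)) , trans (only y ey) (sym (only _ (colour′ p∈ e)))

    not-the-one : ∀ {j} → ExactlyOne D P j → k ≢ j
    not-the-one one e with same-point one
    ... | p , p∈ , only = new p∈ (proj₁ (only x e))

    -- A pigeonhole argument: otherwise the sectors on the right, which are as
    -- many as those on the left, inject into the sectors met on the left.
    free-sector : {I J : Set} (h : I ↔ J) (f : Ω → I) (g : Ω → J) →
      (∀ j → Σ Ω λ y → g y ≡ j) →
      (∀ {p} → p ∈ L → f x ≢ f (proj₁ p)) →
      (∀ {p q} → p ∈ L → q ∈ L → f (proj₁ p) ≡ f (proj₁ q) → g (proj₂ p) ≡ g (proj₂ q)) →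
      Σ Ω λ y → ∀ {p} → p ∈ L → g y ≢ g (proj₂ p)
    free-sector {I} {J} h f g onto free match
      with dec (Σ Ω λ y → ∀ {p} → p ∈ L → g y ≢ g (proj₂ p))
    ... | yes r = r
    ... | no none = ⊥-elim (clash (pigeonhole (n<1+n (length L)) λ i → idx (Inverse.to h (proj₁ orbit (toℕ i)))))
      where
      met : ∀ j → Σ (Ω × Ω) λ p → p ∈ L × g (proj₂ p) ≡ j
      met j with onto j
      ... | y , refl with dec (Σ (Ω × Ω) λ p → p ∈ L × g (proj₂ p) ≡ g y)
      ...   | yes r = r
      ...   | no n = ⊥-elim (none (y , λ p∈ e → n (_ , p∈ , sym e)))
      idx : J → Fin (length L)
      idx j = index (proj₁ (proj₂ (met j)))
      idx-inj : ∀ {i j} → idx i ≡ idx j → i ≡ j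
      idx-inj {i} {j} e = trans (sym (proj₂ (proj₂ (met i)))) (trans (cong (λ p → g (proj₂ p)) same) (proj₂ (proj₂ (met j))))
        where
        same : proj₁ (met i) ≡ proj₁ (met j)
        same = trans (lookup-index (proj₁ (proj₂ (met i))))
          (trans (cong (lookup L) e) (sym (lookup-index (proj₁ (proj₂ (met j))))))
      back-label : J → I
      back-label j = f (proj₁ (proj₁ (met j)))
      back-label-inj : ∀ {i j} → back-label i ≡ back-label j → i ≡ j
      back-label-inj {i} {j} e = trans (sym (proj₂ (proj₂ (met i))))
        (trans (match (proj₁ (proj₂ (met i))) (proj₁ (proj₂ (met j))) e) (proj₂ (proj₂ (met j))))
      h-inj : ∀ {i j} → Inverse.to h i ≡ Inverse.to h j → i ≡ j
      h-inj e = trans (sym (Inverse.strictlyInverseʳ h _))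
        (trans (cong (Inverse.from h) e) (Inverse.strictlyInverseʳ h _))
      -- Following `h` by `back-label` injects `I` into itself and misses the sector of `x`, so the
      -- orbit of that sector is infinite, while `idx` embeds `J` into the positions of `L`.
      orbit : Σ (ℕ → I) λ o → ∀ m n → o m ≡ o n → m ≡ n
      orbit = escaping-orbit (λ i → back-label (Inverse.to h i)) (f x)
        (λ e → h-inj (back-label-inj e)) (λ i e → free (proj₁ (proj₂ (met (Inverse.to h i)))) (sym e))
      clash : (Σ (Fin (suc (length L))) λ i → Σ (Fin (suc (length L))) λ j → toℕ i < toℕ j ×
        idx (Inverse.to h (proj₁ orbit (toℕ i))) ≡ idx (Inverse.to h (proj₁ orbit (toℕ j)))) → ⊥
      clash (i , j , i<j , e) = <-irrefl (proj₂ orbit _ _ (h-inj (idx-inj e))) i<j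

    -- Only `k` different from `j` needs more than the majority lemma. In case (b) the edge would
    -- then put `x` into the sector of some point of `L` with its colour, against `free`; in case
    -- (c) `x` would be the unique point, which is already in `L`.
    recolour : ∀ {j a b z a′ b′ z′} → P a ≡ j → P b ≡ j → Distinct a′ b′ z′ →
      P a′ ≡ j → P b′ ≡ j → a ≢ b → (∀ {p} → p ∈ L → ¬ Sim a b z x (proj₁ p)) →
      ∀ y → Σ Ω λ y′ → P y′ ≡ k × Sim a′ b′ z′ y′ y
    recolour {j} {a′ = a′} {b′} {z′} pa pb dist′ pa′ pb′ a≢b free y with dec (k ≡ j)
    ... | yes refl = sectors-meet-majority dense trichotomy dist′ pa′ pb′ y
    ... | no k≢j = go trichotomy
      where
      go : Trichotomy → Σ Ω λ y′ → P y′ ≡ k × Sim a′ b′ z′ y′ y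
      go (inj₁ inf) = sectors-meet-both dense inf (Sim-node dist′) Sim-apart _ y
      go (inj₂ (inj₁ edge)) with bi k
      ... | p , p∈ , e = ⊥-elim (free p∈ (inj₁ (edge-sector edge refl e
              (λ q → k≢j (trans (sym q) pa)) (λ q → k≢j (trans (sym q) pb)))))
      go (inj₂ (inj₂ one)) with ExactlyOne-some one
      ... | i , one-i with dec (j ≡ i)
      ...   | yes refl = ⊥-elim (a≢b (trans (proj₂ (proj₂ one-i) _ pa) (sym (proj₂ (proj₂ one-i) _ pb))))
      ...   | no j≢i = ⊥-elim (not-the-one one-i (trans (¬-not k≢j) (sym (¬-not (≢-sym j≢i)))))

    extend-at-node : ∀ {t₁ t₂ t₃} → t₁ ∈ L → t₂ ∈ L → t₃ ∈ L →
      Distinct (proj₁ t₁) (proj₁ t₂) (proj₁ t₃) → P (proj₁ t₁) ≡ P (proj₁ t₂) →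
      (∀ {p} → p ∈ L → ¬ Sim (proj₁ t₁) (proj₁ t₂) (proj₁ t₃) x (proj₁ p)) →
      Σ Ω λ y → PartialIso ((x , y) ∷ L)
    extend-at-node {t₁} {t₂} {t₃} t₁∈ t₂∈ t₃∈ dist@(apart d₁₂ d₁₃ d₂₃) e free =
      y , extend (Sim-node dist) (Sim-node dist′) iso free alone to from
            t₁∈ t₂∈ (Apart.ab Sim-apart) (sym (proj₁ (proj₂ coloured)))
      where
      dist′ : Distinct (proj₂ t₁) (proj₂ t₂) (proj₂ t₃)
      dist′ = apart (λ q → d₁₂ (Preserves-≡ (forth iso) t₁∈ t₂∈ q))
                    (λ q → d₁₃ (Preserves-≡ (forth iso) t₁∈ t₃∈ q))
                    (λ q → d₂₃ (Preserves-≡ (forth iso) t₂∈ t₃∈ q))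
      module N = NodeProperties (Sim-node dist)
      module N′ = NodeProperties (Sim-node dist′)
      module Lab = N.Labelling c c-inj
      module Lab′ = N′.Labelling c c-inj
      e₁′ : P (proj₂ t₁) ≡ P (proj₁ t₁)
      e₁′ = colour′ t₁∈ refl
      e₂′ : P (proj₂ t₂) ≡ P (proj₁ t₁)
      e₂′ = colour′ t₂∈ (sym e)
      to : ∀ {p q} → p ∈ L → q ∈ L → Sim (proj₁ t₁) (proj₁ t₂) (proj₁ t₃) (proj₁ p) (proj₁ q) →
        Sim (proj₂ t₁) (proj₂ t₂) (proj₂ t₃) (proj₂ p) (proj₂ q)
      to p q (inj₁ d) = inj₁ (forth iso p q t₁∈ t₂∈ d)
      to p q (inj₂ (inj₁ d)) = inj₂ (inj₁ (forth iso p q t₁∈ t₃∈ d))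
      to p q (inj₂ (inj₂ d)) = inj₂ (inj₂ (forth iso p q t₂∈ t₃∈ d))
      from : ∀ {p q} → p ∈ L → q ∈ L → Sim (proj₂ t₁) (proj₂ t₂) (proj₂ t₃) (proj₂ p) (proj₂ q) →
        Sim (proj₁ t₁) (proj₁ t₂) (proj₁ t₃) (proj₁ p) (proj₁ q)
      from p q (inj₁ d) = inj₁ (back iso p q t₁∈ t₂∈ d)
      from p q (inj₂ (inj₁ d)) = inj₂ (inj₁ (back iso p q t₁∈ t₃∈ d))
      from p q (inj₂ (inj₂ d)) = inj₂ (inj₂ (back iso p q t₂∈ t₃∈ d))
      h : Lab.Sector ↔ Lab′.Sector
      -- The colour shared by `t₁` and `t₂` meets every sector at both nodes, so condition (2) for
      -- that colour compares the sectors in Ω.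
      h = equinumerous (P (proj₁ t₁)) _ _ _ _
        (Lab.label-splitting (sectors-meet-majority dense trichotomy dist refl (sym e)) Sim-apart)
        (Lab′.label-splitting (sectors-meet-majority dense trichotomy dist′ e₁′ e₂′) Sim-apart)
      sectorless : Σ Ω λ y → ∀ {p} → p ∈ L → Lab′.label y ≢ Lab′.label (proj₂ p)
      sectorless = free-sector h Lab.label Lab′.label (λ j → proj₁ j , Lab′.label-onto j)
        (λ p∈ q → free p∈ (Lab.label-injective q))
        (λ p q r → Lab′.label-cong (to p q (Lab.label-injective r)))
      coloured : Σ Ω λ y → P y ≡ k × Sim (proj₂ t₁) (proj₂ t₂) (proj₂ t₃) y (proj₁ sectorless)
      coloured = recolour refl (sym e) dist′ e₁′ e₂′ d₁₂ free (proj₁ sectorless)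
      y : Ω
      y = proj₁ coloured
      alone : ∀ {p} → p ∈ L → ¬ Sim (proj₂ t₁) (proj₂ t₂) (proj₂ t₃) y (proj₂ p)
      alone p∈ s = proj₂ sectorless p∈
        (Lab′.label-cong (N′.~-trans (N′.~-sym (proj₂ (proj₂ coloured))) s))

    -- A point y with D a u y p for the farthest u also has D a e y p for all
    -- other e on the side of a, so finitely many density conditions become one.
    farthest : ∀ {a p : Ω × Ω} → a ∈ L → (Q : Ω × Ω → Set) → Q a →
      Σ (Ω × Ω) λ u → u ∈ L × Q u × (∀ {e} → e ∈ L → Q e → ¬ D (proj₂ a) (proj₂ u) (proj₂ e) (proj₂ p))
    farthest {a} {p} a∈ Q qa
      with minimal (λ e m → D (proj₂ a) (proj₂ m) (proj₂ e) (proj₂ p))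
             (λ zy ym → far-trans ym zy) (λ d → ≢₂₃ d refl) Q a qa L
    ... | u , qu , inj₁ refl , low = u , a∈ , qu , λ e∈ qe → low _ e∈ qe
    ... | u , qu , inj₂ u∈ , low = u , u∈ , qu , λ e∈ qe → low _ e∈ qe

    beyond : ∀ {a u p y e} → D a u y p → ¬ D a u e p → D a e y p
    beyond {e = e} d n with split d e
    ... | inj₁ (_ , f) = ⊥-elim (n (swapR f))
    ... | inj₂ (f , _) = f

    -- The colour edge lies on the image edge: the `V` side has colour `k`, while `y` and, as is
    -- shown first, the `U` side have the other colour. Every point of colour `k` is then beyond
    -- `u`, and only the condition at `v` remains.
    colour-across : PartitionIsTrueEdge D P → {U V : Ω × Ω → Set} →
      (∀ {e} → e ∈ L → U e ⊎ V e) → (∀ {e} → e ∈ L → V e → P (proj₁ e) ≡ k) →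
      ∀ {a u p v} → a ∈ L → U a → u ∈ L → U u → p ∈ L → V p → v ∈ L → V v →
      proj₂ a ≢ proj₂ p → proj₂ a ≢ proj₂ v →
      ∀ y → (∀ {e} → e ∈ L → U e → D (proj₂ a) (proj₂ e) y (proj₂ p)) → P y ≢ k →
      Σ Ω λ z → P z ≡ k × D (proj₂ a) (proj₂ u) z (proj₂ p) × D (proj₂ p) (proj₂ v) z (proj₂ a)
    colour-across edge {U} {V} cover Vk {a} {u} {p} {v} a∈ Ua u∈ Uu p∈ Vp v∈ Vv a≢p a≢v y near y≢k = go (dec (proj₂ v ≡ proj₂ p))
      where
      pk : P (proj₂ p) ≡ k
      pk = colour′ p∈ (Vk p∈ Vp)
      U-not-k : ∀ {e} → e ∈ L → U e → P (proj₂ e) ≢ k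
      U-not-k {e} e∈ Ue ek with bi (not k)
      ... | l , l∈ , lk with cover l∈
      ...   | inj₂ Vl = not-¬ (Vk l∈ Vl) lk
      -- With `e` and `proj₂ p` of colour `k` and `l` and `y` of the other, the colour edge would
      -- cross the edge separating `l`, `e` from `y`, `proj₂ p`.
      ...   | inj₁ Ul = excl (join (swapL (near l∈ Ul)) (near e∈ Ue))
                (swapS (edge-sector edge ek pk (λ q → not-¬ q (colour′ l∈ lk)) y≢k))
      across : ∀ {z} → P z ≡ k → D (proj₂ a) (proj₂ u) z (proj₂ p)
      across zk = swapS (edge-sector edge zk pk (U-not-k a∈ Ua) (U-not-k u∈ Uu))
      go : Dec (proj₂ v ≡ proj₂ p) →
        Σ Ω λ z → P z ≡ k × D (proj₂ a) (proj₂ u) z (proj₂ p) × D (proj₂ p) (proj₂ v) z (proj₂ a)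
      go (yes v≡p) with other-point edge pk
      ... | z , zk , z≢p = z , zk , across zk
          , subst (λ t → D (proj₂ p) t z (proj₂ a)) (sym v≡p) (point (≢-sym z≢p) (≢-sym a≢p))
      -- At the node spanned by the images of `v`, `p`, `a`, a point of colour `k` in the sector of
      -- `a` lies on the required side of `v`.
      go (no v≢p) with sectors-meet-majority dense trichotomy {b = proj₂ p} {z = proj₂ a}
                         (apart v≢p (≢-sym a≢v) (≢-sym a≢p)) (colour′ v∈ (Vk v∈ Vv)) pk (proj₂ a)
      ... | z , zk , inj₁ d = z , zk , across zk , swapL (swapS d)
      ... | z , zk , inj₂ (inj₁ d) = ⊥-elim (≢₂₄ d refl)
      ... | z , zk , inj₂ (inj₂ d) = ⊥-elim (≢₂₄ d refl)

    module AtEdge {a p : Ω × Ω} (a∈ : a ∈ L) (p∈ : p ∈ L)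
      (dist : Distinct x (proj₁ a) (proj₁ p))
      (free : ∀ {e} → e ∈ L → ¬ Sim x (proj₁ a) (proj₁ p) x (proj₁ e))
      (cover : ∀ {e} → e ∈ L → Sim x (proj₁ a) (proj₁ p) (proj₁ e) (proj₁ a)
                             ⊎ Sim x (proj₁ a) (proj₁ p) (proj₁ e) (proj₁ p)) where

      module N = NodeProperties (Sim-node dist)

      U V : Ω × Ω → Set
      U e = Sim x (proj₁ a) (proj₁ p) (proj₁ e) (proj₁ a)
      V e = Sim x (proj₁ a) (proj₁ p) (proj₁ e) (proj₁ p)

      UV-apart : ∀ {e f} → Sim x (proj₁ a) (proj₁ p) e (proj₁ a) → Sim x (proj₁ a) (proj₁ p) f (proj₁ p) →
        ¬ Sim x (proj₁ a) (proj₁ p) e f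
      UV-apart Ue Vf s = Apart.bc Sim-apart (N.~-trans (N.~-sym Ue) (N.~-trans s Vf))

      far-a : Σ (Ω × Ω) λ u → u ∈ L × U u × (∀ {e} → e ∈ L → U e → ¬ D (proj₂ a) (proj₂ u) (proj₂ e) (proj₂ p))
      far-a = farthest {p = p} a∈ U N.~-refl

      far-p : Σ (Ω × Ω) λ v → v ∈ L × V v × (∀ {e} → e ∈ L → V e → ¬ D (proj₂ p) (proj₂ v) (proj₂ e) (proj₂ a))
      far-p = farthest {p = a} p∈ V N.~-refl

      u v : Ω × Ω
      u = proj₁ far-a
      v = proj₁ far-p

      u∈ : u ∈ L
      u∈ = proj₁ (proj₂ far-a)
      v∈ : v ∈ L
      v∈ = proj₁ (proj₂ far-p)
      Uu : U u
      Uu = proj₁ (proj₂ (proj₂ far-a))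
      Vv : V v
      Vv = proj₁ (proj₂ (proj₂ far-p))

      OnEdge : Ω → Set
      OnEdge y = D (proj₂ a) (proj₂ u) y (proj₂ p) × D (proj₂ p) (proj₂ v) y (proj₂ a)

      near-a : ∀ {y} → OnEdge y → ∀ {e} → e ∈ L → U e → D (proj₂ a) (proj₂ e) y (proj₂ p)
      near-a (d , _) e∈ Ue = beyond d (proj₂ (proj₂ (proj₂ far-a)) e∈ Ue)

      near-p : ∀ {y} → OnEdge y → ∀ {e} → e ∈ L → V e → D (proj₂ p) (proj₂ e) y (proj₂ a)
      near-p (_ , d) e∈ Ve = beyond d (proj₂ (proj₂ (proj₂ far-p)) e∈ Ve)

      across : D (proj₂ a) (proj₂ u) (proj₂ p) (proj₂ v)
      across = forth iso a∈ u∈ p∈ v∈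
        (N.sector (N.~-sym Uu) (UV-apart N.~-refl N.~-refl) (UV-apart N.~-refl Vv))

      OnEdge-distinct : ∀ {y} → OnEdge y → Distinct y (proj₂ a) (proj₂ p)
      OnEdge-distinct (d , d′) = apart (≢-sym (≢₁₃ d)) (≢-sym (≢₁₃ d′)) (≢₁₄ d)

      some-point : Σ Ω OnEdge
      some-point with proj₂ dense _ _ _ _ across
      ... | y , _ , d₂ , _ , d₄ = y , swapR d₄ , swapR (swapS d₂)

      OnEdge-new : ∀ {y} → OnEdge y → ∀ {e} → e ∈ L → y ≢ proj₂ e
      OnEdge-new on e∈ q with cover e∈
      ... | inj₁ Ue = ≢₂₃ (near-a on e∈ Ue) (sym q)
      ... | inj₂ Ve = ≢₂₃ (near-p on e∈ Ve) (sym q)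

      -- Suppose both sides contain a point of the other colour, and let `l` in `L` have colour `k`.
      -- The colour edge pairs `l` with `x`, but the node of `x` pairs `l` with the point on its own
      -- side; D2 excludes this.
      one-side-k : PartitionIsTrueEdge D P →
        (∀ {e} → e ∈ L → V e → P (proj₁ e) ≡ k) ⊎ (∀ {e} → e ∈ L → U e → P (proj₁ e) ≡ k)
      one-side-k edge with dec (Σ (Ω × Ω) λ e → e ∈ L × V e × P (proj₁ e) ≢ k)
      ... | no none = inj₁ all
        where
        all : ∀ {e} → e ∈ L → V e → P (proj₁ e) ≡ k
        all {e} e∈ Ve with dec (P (proj₁ e) ≡ k)
        ... | yes q = q
        ... | no n = ⊥-elim (none (e , e∈ , Ve , n))
      ... | yes (v₀ , v₀∈ , Vv₀ , v₀≢k) = inj₂ all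
        where
        all : ∀ {e} → e ∈ L → U e → P (proj₁ e) ≡ k
        all {e} e∈ Ue with dec (P (proj₁ e) ≡ k)
        ... | yes q = q
        ... | no e≢k with bi k
        ...   | l , l∈ , lk with cover l∈
        ...     | inj₁ Ul = ⊥-elim (excl (edge-sector edge lk refl e≢k v₀≢k)
                    (N.sector (N.~-trans Ul (N.~-sym Ue)) (N.≁-sym (free l∈)) (UV-apart Ul Vv₀)))
        ...     | inj₂ Vl = ⊥-elim (excl (edge-sector edge lk refl v₀≢k e≢k)
                    (N.sector (N.~-trans Vl (N.~-sym Vv₀)) (N.≁-sym (free l∈)) (N.≁-sym (UV-apart Ue Vl))))

      coloured-point : Σ Ω λ y → P y ≡ k × OnEdge y
      coloured-point = go trichotomy some-point
        where
        go : Trichotomy → Σ Ω OnEdge → Σ Ω λ y → P y ≡ k × OnEdge y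
        -- The whole sector of `y₀` at the node spanned by `y₀` and the images of `a` and `p` lies
        -- on the edge, and it contains both colours.
        go (inj₁ inf) (y₀ , on@(d , d′)) with
          sectors-meet-both dense inf (Sim-node (OnEdge-distinct on)) Sim-apart k y₀
        ... | y , yk , y~y₀ = y , yk
              , N₀.sector (inj₂ (inj₁ d)) (λ s → A.ab (N₀.~-sym (N₀.~-trans s y~y₀))) A.bc
              , N₀.sector (inj₁ d′) (λ s → A.ac (N₀.~-sym (N₀.~-trans s y~y₀))) (N₀.≁-sym A.bc)
          where
          module N₀ = NodeProperties (Sim-node (OnEdge-distinct on))
          module A = Apart (Sim-apart {y₀} {proj₂ a} {proj₂ p})
        go (inj₂ (inj₁ edge)) (y₀ , on) with dec (P y₀ ≡ k) | one-side-k edge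
        ... | yes yk | _ = y₀ , yk , on
        ... | no y≢k | inj₁ Vk = colour-across edge cover Vk a∈ N.~-refl u∈ Uu p∈ N.~-refl v∈ Vv
                (≢₁₃ across) (≢₁₄ across) y₀ (near-a on) y≢k
        ... | no y≢k | inj₂ Uk with colour-across edge (λ e∈ → [ inj₂ , inj₁ ]′ (cover e∈)) Uk
                p∈ N.~-refl v∈ Vv a∈ N.~-refl u∈ Uu
                (≢-sym (≢₁₃ across)) (≢-sym (≢₂₃ across)) y₀ (near-p on) y≢k
        ...   | y , yk , d , d′ = y , yk , d′ , d
        -- The unique point of its colour is an image of `L`, hence not on the edge; so `y₀` has the
        -- other colour, as `x` does.
        go (inj₂ (inj₂ one)) (y₀ , on) with ExactlyOne-some one
        ... | j , one-j with dec (P y₀ ≡ j)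
        ...   | no n = y₀ , trans (¬-not n) (sym (¬-not (not-the-one one-j))) , on
        ...   | yes q with same-point one-j
        ...     | m , m∈ , only = ⊥-elim (OnEdge-new on m∈ (proj₂ (only y₀ q)))

      extend-at-edge : Σ Ω λ y → PartialIso ((x , y) ∷ L)
      extend-at-edge with coloured-point
      ... | y , yk , on = y , extend (Sim-node dist) (Sim-node (OnEdge-distinct on)) iso free free′ to from
              a∈ p∈ (Apart.bc Sim-apart) (sym yk)
        where
        module N′ = NodeProperties (Sim-node (OnEdge-distinct on))
        module A = Apart (Sim-apart {y} {proj₂ a} {proj₂ p})
        U′ : ∀ {e} → e ∈ L → U e → Sim y (proj₂ a) (proj₂ p) (proj₂ e) (proj₂ a)
        U′ e∈ Ue = inj₂ (inj₁ (swapL (near-a on e∈ Ue)))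
        V′ : ∀ {e} → e ∈ L → V e → Sim y (proj₂ a) (proj₂ p) (proj₂ e) (proj₂ p)
        V′ e∈ Ve = inj₁ (swapL (near-p on e∈ Ve))
        free′ : ∀ {e} → e ∈ L → ¬ Sim y (proj₂ a) (proj₂ p) y (proj₂ e)
        free′ e∈ s with cover e∈
        ... | inj₁ Ue = A.ab (N′.~-trans s (U′ e∈ Ue))
        ... | inj₂ Ve = A.ac (N′.~-trans s (V′ e∈ Ve))
        to : ∀ {e f} → e ∈ L → f ∈ L → Sim x (proj₁ a) (proj₁ p) (proj₁ e) (proj₁ f) →
          Sim y (proj₂ a) (proj₂ p) (proj₂ e) (proj₂ f)
        to e∈ f∈ s with cover e∈ | cover f∈
        ... | inj₁ Ue | inj₁ Uf = N′.~-trans (U′ e∈ Ue) (N′.~-sym (U′ f∈ Uf))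
        ... | inj₂ Ve | inj₂ Vf = N′.~-trans (V′ e∈ Ve) (N′.~-sym (V′ f∈ Vf))
        ... | inj₁ Ue | inj₂ Vf = ⊥-elim (UV-apart Ue Vf s)
        ... | inj₂ Ve | inj₁ Uf = ⊥-elim (UV-apart Uf Ve (N.~-sym s))
        from : ∀ {e f} → e ∈ L → f ∈ L → Sim y (proj₂ a) (proj₂ p) (proj₂ e) (proj₂ f) →
          Sim x (proj₁ a) (proj₁ p) (proj₁ e) (proj₁ f)
        from e∈ f∈ s with cover e∈ | cover f∈
        ... | inj₁ Ue | inj₁ Uf = N.~-trans Ue (N.~-sym Uf)
        ... | inj₂ Ve | inj₂ Vf = N.~-trans Ve (N.~-sym Vf)
        ... | inj₁ Ue | inj₂ Vf = ⊥-elim (A.bc (N′.~-trans (N′.~-sym (U′ e∈ Ue)) (N′.~-trans s (V′ f∈ Vf))))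
        ... | inj₂ Ve | inj₁ Uf = ⊥-elim (A.bc (N′.~-sym (N′.~-trans (N′.~-sym (V′ e∈ Ve)) (N′.~-trans s (U′ f∈ Uf)))))

    -- The node where `x` joins the tree of `L` is spanned by `x`, `a`, `p`. If a third sector
    -- besides those of `a` and `p` meets `L`, the node belongs to the tree of `L`; otherwise it is
    -- interior to an edge.
    one-point-new : Σ Ω λ y → PartialIso ((x , y) ∷ L)
    one-point-new with bi true | bi false
    ... | p , p∈ , pt | q , q∈ , qf
      -- No branch of `L` leaves the path from `x` to `p` before that of `a`, which is what makes
      -- `x` alone. Starting from `q`, whose colour differs from that of `p`, rules out `a` equal to
      -- `p`.
      with minimal (λ e m → D x (proj₁ e) (proj₁ m) (proj₁ p)) far-trans (λ d → ≢₂₃ d refl)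
             (λ _ → ⊤) q tt L
    ...   | a , _ , pos , low = go (dec (Σ (Ω × Ω) λ b → b ∈ L × ¬ (proj₁ b ~ proj₁ a) × ¬ (proj₁ b ~ proj₁ p)))
      where
      a∈ : a ∈ L
      a∈ = [ (λ { refl → q∈ }) , (λ i → i) ]′ pos
      q≢p : proj₁ q ≢ proj₁ p
      q≢p e = not-¬ qf (trans (cong P e) pt)
      a≢p : proj₁ a ≢ proj₁ p
      a≢p e = low q q∈ tt (subst (λ t → D x (proj₁ q) t (proj₁ p)) (sym e) (D4 _ _ _ (new p∈) q≢p))
      dist : Distinct x (proj₁ a) (proj₁ p)
      dist = apart (new a∈) (new p∈) a≢p
      _~_ : Ω → Ω → Set
      _~_ = Sim x (proj₁ a) (proj₁ p)
      open NodeProperties (Sim-node dist)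
      free : ∀ {e} → e ∈ L → ¬ (x ~ proj₁ e)
      free e∈ (inj₁ d) = ≢₁₃ d refl
      free e∈ (inj₂ (inj₁ d)) = ≢₁₃ d refl
      free e∈ (inj₂ (inj₂ d)) = low _ e∈ tt d
      at-node : ∀ {s t r} → s ∈ L → t ∈ L → r ∈ L → Apart _~_ (proj₁ s) (proj₁ t) (proj₁ r) →
        P (proj₁ s) ≡ P (proj₁ t) → Σ Ω λ y → PartialIso ((x , y) ∷ L)
      at-node s t r ap e = extend-at-node s t r (Apart⇒Distinct ap) e (λ m∈ m → free m∈ (Sim⇒~ ap m))
      go : Dec (Σ (Ω × Ω) λ b → b ∈ L × ¬ (proj₁ b ~ proj₁ a) × ¬ (proj₁ b ~ proj₁ p)) →
        Σ Ω λ y → PartialIso ((x , y) ∷ L)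
      go (no none) = AtEdge.extend-at-edge a∈ p∈ dist free cover
        where
        cover : ∀ {e} → e ∈ L → proj₁ e ~ proj₁ a ⊎ proj₁ e ~ proj₁ p
        cover {e} e∈ with dec (proj₁ e ~ proj₁ a) | dec (proj₁ e ~ proj₁ p)
        ... | yes s | _ = inj₁ s
        ... | no _ | yes s = inj₂ s
        ... | no m | no n = ⊥-elim (none (e , e∈ , m , n))
      go (yes (b , b∈ , b≁a , b≁p)) with dec (P (proj₁ b) ≡ P (proj₁ a)) | dec (P (proj₁ b) ≡ P (proj₁ p))
      ... | yes e | _ = at-node b∈ a∈ p∈ (apart b≁a b≁p (Apart.bc Sim-apart)) e
      ... | no _ | yes e = at-node b∈ p∈ a∈ (apart b≁p b≁a (≁-sym (Apart.bc Sim-apart))) e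
      -- Of three points two share a colour; here these are `a` and `p`, both unlike `b`.
      ... | no m | no n = at-node a∈ p∈ b∈ (apart (Apart.bc Sim-apart) (≁-sym b≁a) (≁-sym b≁p))
              (trans (¬-not (≢-sym m)) (sym (¬-not (≢-sym n))))

  -- Sufficiency: back and forth

  one-point : ∀ {L} → PartialIso L → Bichromatic L → ∀ x → Σ Ω λ y → PartialIso ((x , y) ∷ L)
  one-point {L} iso bi x with dec (Σ (Ω × Ω) λ p → p ∈ L × proj₁ p ≡ x)
  ... | yes ((_ , y) , p∈ , refl) = y , PartialIso-⊆ (λ { (here refl) → p∈ ; (there q∈) → q∈ }) iso
  ... | no none = OnePoint.one-point-new iso bi x (λ p∈ e → none (_ , p∈ , sym e))

  Bichromatic-∷ : ∀ {L p} → Bichromatic L → Bichromatic (p ∷ L)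
  Bichromatic-∷ bi k with bi k
  ... | q , q∈ , e = q , there q∈ , e

  record State : Set where
    field
      pairs       : Partial
      partial-iso : PartialIso pairs
      bichromatic : Bichromatic pairs

  open State

  add-left : (S : State) (x : Ω) → Σ State λ T →
    (∀ {p} → p ∈ pairs S → p ∈ pairs T) × Σ Ω λ y → (x , y) ∈ pairs T
  add-left S x with one-point (partial-iso S) (bichromatic S) x
  ... | y , iso = record { pairs = _ ; partial-iso = iso ; bichromatic = Bichromatic-∷ (bichromatic S) }
      , there , y , here refl

  flip-state : State → State
  flip-state S = record
    { pairs = map swap (pairs S)
    ; partial-iso = PartialIso-swap (partial-iso S)
    ; bichromatic = λ k → let (p , p∈ , e) = bichromatic S k in
        swap p , ∈-map⁺ swap p∈ , trans (sym (PartialIso.colour (partial-iso S) p∈)) e }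

  add-both : (S : State) (x : Ω) → Σ State λ T → (∀ {p} → p ∈ pairs S → p ∈ pairs T) ×
    (Σ Ω λ y → (x , y) ∈ pairs T) × (Σ Ω λ y → (y , x) ∈ pairs T)
  add-both S x with add-left S x
  ... | T , sub , y , xy∈ with add-left (flip-state T) x
  ...   | T′ , sub′ , z , xz∈ = flip-state T′
        , (λ p∈ → ∈-map⁺ swap (sub′ (∈-map⁺ swap (sub p∈))))
        , (y , ∈-map⁺ swap (sub′ (∈-map⁺ swap xy∈)))
        , (z , ∈-map⁺ swap xz∈)

  module BackAndForth (S₀ : State) where

    -- The index `c` need not be onto, so the state is left unchanged when no point has index `n`.
    -- Stage `suc n` therefore handles index `n`.
    step : (n : ℕ) (S : State) → Dec (Σ Ω λ x → c x ≡ n) →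
      Σ State λ T → (∀ {p} → p ∈ pairs S → p ∈ pairs T) ×
        (∀ x → c x ≡ n → (Σ Ω λ y → (x , y) ∈ pairs T) × (Σ Ω λ y → (y , x) ∈ pairs T))
    step n S (no none) = S , (λ p∈ → p∈) , λ x e → ⊥-elim (none (x , e))
    step n S (yes (x , e)) with add-both S x
    ... | T , sub , l , r = T , sub , λ x′ e′ → subst Covered (c-inj (trans e (sym e′))) (l , r)
      where
      Covered : Ω → Set
      Covered x = (Σ Ω λ y → (x , y) ∈ pairs T) × (Σ Ω λ y → (y , x) ∈ pairs T)

    stage : ℕ → State
    stage zero = S₀
    stage (suc n) = proj₁ (step n (stage n) (dec _))

    stage-mono : ∀ {m n} → m ≤′ n → ∀ {p} → p ∈ pairs (stage m) → p ∈ pairs (stage n)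
    stage-mono ≤′-refl p∈ = p∈
    stage-mono {n = suc n} (≤′-step m≤n) p∈ =
      proj₁ (proj₂ (step n (stage n) (dec _))) (stage-mono m≤n p∈)

    _↦_ : Ω → Ω → Set
    x ↦ y = Σ ℕ λ n → (x , y) ∈ pairs (stage n)

    covered : ∀ x → (Σ Ω λ y → (x , y) ∈ pairs (stage (suc (c x)))) ×
                    (Σ Ω λ y → (y , x) ∈ pairs (stage (suc (c x))))
    covered x = proj₂ (proj₂ (step (c x) (stage (c x)) (dec _))) x refl

    image : ∀ x → Σ Ω (x ↦_)
    image x = proj₁ (proj₁ (covered x)) , _ , proj₂ (proj₁ (covered x))

    preimage : ∀ y → Σ Ω (_↦ y)
    preimage y = proj₁ (proj₂ (covered y)) , _ , proj₂ (proj₂ (covered y))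

    raiseˡ : ∀ {x y} (m n : ℕ) → (x , y) ∈ pairs (stage m) → (x , y) ∈ pairs (stage (m ⊔ n))
    raiseˡ m n = stage-mono (≤⇒≤′ (m≤m⊔n m n))

    raiseʳ : ∀ {x y} (m n : ℕ) → (x , y) ∈ pairs (stage n) → (x , y) ∈ pairs (stage (m ⊔ n))
    raiseʳ m n = stage-mono (≤⇒≤′ (m≤n⊔m m n))

    functional : ∀ {x y y′} → x ↦ y → x ↦ y′ → y ≡ y′
    functional (m , p) (n , q) =
      Preserves-≡ (back (partial-iso (stage (m ⊔ n)))) (raiseˡ m n p) (raiseʳ m n q) refl

    injective : ∀ {x x′ y} → x ↦ y → x′ ↦ y → x ≡ x′
    injective (m , p) (n , q) =
      Preserves-≡ (forth (partial-iso (stage (m ⊔ n)))) (raiseˡ m n p) (raiseʳ m n q) refl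

    ↦-D : ∀ {x₁ x₂ x₃ x₄ y₁ y₂ y₃ y₄} → x₁ ↦ y₁ → x₂ ↦ y₂ → x₃ ↦ y₃ → x₄ ↦ y₄ →
      D x₁ x₂ x₃ x₄ ⇔ D y₁ y₂ y₃ y₄
    ↦-D (n₁ , p₁) (n₂ , p₂) (n₃ , p₃) (n₄ , p₄) = mk⇔ (forth iso q₁ q₂ q₃ q₄) (back iso q₁ q₂ q₃ q₄)
      where
      iso = partial-iso (stage ((n₁ ⊔ n₂) ⊔ (n₃ ⊔ n₄)))
      q₁ = raiseˡ (n₁ ⊔ n₂) (n₃ ⊔ n₄) (raiseˡ n₁ n₂ p₁)
      q₂ = raiseˡ (n₁ ⊔ n₂) (n₃ ⊔ n₄) (raiseʳ n₁ n₂ p₂)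
      q₃ = raiseʳ (n₁ ⊔ n₂) (n₃ ⊔ n₄) (raiseˡ n₃ n₄ p₃)
      q₄ = raiseʳ (n₁ ⊔ n₂) (n₃ ⊔ n₄) (raiseʳ n₃ n₄ p₄)

    automorphism : Ω ↔ Ω
    automorphism = mk↔ₛ′ (λ x → proj₁ (image x)) (λ y → proj₁ (preimage y))
      (λ y → functional (proj₂ (image _)) (proj₂ (preimage y)))
      (λ x → injective (proj₂ (preimage _)) (proj₂ (image x)))

    automorphism-correct : IsAutomorphism D P automorphism
    automorphism-correct =
      (λ w x y z → ↦-D (proj₂ (image w)) (proj₂ (image x)) (proj₂ (image y)) (proj₂ (image z)))
      , λ x → sym (PartialIso.colour (partial-iso (stage _)) (proj₂ (proj₂ (image x))))

    automorphism-extends : ∀ {x y} → (x , y) ∈ pairs S₀ → Inverse.to automorphism x ≡ y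
    automorphism-extends p∈ = functional (proj₂ (image _)) (0 , p∈)

  homogeneous : PHomogeneous D P
  homogeneous n a b _ _ (i , ai) (j , aj) _ _ D-iso P-iso =
    automorphism , automorphism-correct , λ i → automorphism-extends (∈-tabulate⁺ i)
    where
    L : Partial
    L = tabulate (λ i → a i , b i)
    S₀ : State
    S₀ = record
      { pairs = L
      ; partial-iso = record { forth = forth₀ ; back = back₀ ; colour = colour₀ }
      ; bichromatic = λ { true → _ , ∈-tabulate⁺ i , ai ; false → _ , ∈-tabulate⁺ j , aj } }
      where
      forth₀ : Preserves proj₁ proj₂ L
      forth₀ p q r s d with ∈-tabulate⁻ p | ∈-tabulate⁻ q | ∈-tabulate⁻ r | ∈-tabulate⁻ s
      ... | _ , refl | _ , refl | _ , refl | _ , refl = Equivalence.to (D-iso _ _ _ _) d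
      back₀ : Preserves proj₂ proj₁ L
      back₀ p q r s d with ∈-tabulate⁻ p | ∈-tabulate⁻ q | ∈-tabulate⁻ r | ∈-tabulate⁻ s
      ... | _ , refl | _ , refl | _ , refl | _ , refl = Equivalence.from (D-iso _ _ _ _) d
      colour₀ : ∀ {p} → p ∈ L → P (proj₁ p) ≡ P (proj₂ p)
      colour₀ p with ∈-tabulate⁻ p
      ... | _ , refl = sym (P-iso _)
    open BackAndForth S₀

-- Necessity: automorphisms from homogeneity

module Necessity {Ω : Set} {D : Ω → Ω → Ω → Ω → Set} (isD : IsDSet D) (dec : (A : Set) → Dec A)
  (P : Ω → Bool) (c : Ω → ℕ) (c-inj : ∀ {x y} → c x ≡ c y → x ≡ y)
  (proper : IsProper D) (inhabited : ∀ k → Σ Ω λ x → P x ≡ k) (hom : PHomogeneous D P) where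

  open IsDSet isD
  open Finite dec
  open DSetTheory isD dec
  open Coloured P c c-inj
  open PartialIso
  open Conditions isD dec P c c-inj

  lookup-injective : (π : Ω × Ω → Ω) → ∀ {L} → AllPairs (λ p q → π p ≢ π q) L →
    ∀ i j → π (lookup L i) ≡ π (lookup L j) → i ≡ j
  lookup-injective π (_ ∷ _) fzero fzero _ = refl
  lookup-injective π (n ∷ _) fzero (fsuc j) e = ⊥-elim (All.lookup n (∈-lookup j) e)
  lookup-injective π (n ∷ _) (fsuc i) fzero e = ⊥-elim (All.lookup n (∈-lookup i) (sym e))
  lookup-injective π (_ ∷ ns) (fsuc i) (fsuc j) e = cong fsuc (lookup-injective π ns i j e)

  record Auto (L : Partial) : Set where
    field
      σ     : Ω ↔ Ω
      is    : IsAutomorphism D P σ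
      sends : ∀ {p} → p ∈ L → Inverse.to σ (proj₁ p) ≡ proj₂ p

    to from : Ω → Ω
    to = Inverse.to σ
    from = Inverse.from σ

    to-from : ∀ y → to (from y) ≡ y
    to-from = Inverse.strictlyInverseˡ σ

    P-to : ∀ x → P (to x) ≡ P x
    P-to = proj₂ is

    P-from : ∀ y → P (from y) ≡ P y
    P-from y = trans (sym (P-to _)) (cong P (to-from y))

    push : ∀ {a b c d a′ b′ c′ d′} → to a ≡ a′ → to b ≡ b′ → to c ≡ c′ → to d ≡ d′ →
      D a b c d → D a′ b′ c′ d′
    push refl refl refl refl = Equivalence.to (proj₁ is _ _ _ _)

    pull : ∀ {a b c d a′ b′ c′ d′} → to a ≡ a′ → to b ≡ b′ → to c ≡ c′ → to d ≡ d′ →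
      D a′ b′ c′ d′ → D a b c d
    pull refl refl refl refl = Equivalence.from (proj₁ is _ _ _ _)

  -- The points `u` and `v` make both substructures bichromatic, as P-homogeneity demands.
  -- Distinctness is asked only on the left, since a partial isomorphism carries it over.
  extend-to-auto : ∀ {L} → PartialIso L → AllPairs (λ p q → proj₁ p ≢ proj₁ q) L →
    ∀ {u v} → u ∈ L → v ∈ L → P (proj₁ u) ≢ P (proj₁ v) → Auto L
  extend-to-auto {L} iso dis {u} {v} u∈ v∈ u≢v
    with hom (length L) (λ i → proj₁ (lookup L i)) (λ i → proj₂ (lookup L i))
           (λ {i} {j} → lookup-injective proj₁ dis i j)
           (λ {i} {j} e → lookup-injective proj₁ dis i j
             (Preserves-≡ (forth iso) (∈-lookup i) (∈-lookup j) e))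
           (some true) (some false) (some′ true) (some′ false)
           (λ i j k l → mk⇔ (forth iso (∈-lookup i) (∈-lookup j) (∈-lookup k) (∈-lookup l))
                            (back iso (∈-lookup i) (∈-lookup j) (∈-lookup k) (∈-lookup l)))
           (λ i → sym (colour iso (∈-lookup i)))
    where
    at : ∀ {p} → p ∈ L → ∀ {k} → P (proj₁ p) ≡ k → Σ (Fin (length L)) λ i → P (proj₁ (lookup L i)) ≡ k
    at p∈ e = index p∈ , trans (cong (λ q → P (proj₁ q)) (sym (lookup-index p∈))) e
    some : ∀ k → Σ (Fin (length L)) λ i → P (proj₁ (lookup L i)) ≡ k
    some k with dec (P (proj₁ u) ≡ k)
    ... | yes e = at u∈ e
    ... | no n = at v∈ (trans (¬-not (≢-sym u≢v)) (sym (¬-not (≢-sym n))))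
    some′ : ∀ k → Σ (Fin (length L)) λ i → P (proj₂ (lookup L i)) ≡ k
    some′ k with some k
    ... | i , e = i , trans (sym (colour iso (∈-lookup i))) e
  ... | σ , is , sends = record
    { σ = σ ; is = is
    ; sends = λ p∈ → subst (λ q → Inverse.to σ (proj₁ q) ≡ proj₂ q) (sym (lookup-index p∈)) (sends (index p∈)) }

  auto₂ : ∀ {a b a′ b′} → P a ≡ P a′ → P b ≡ P b′ → P a ≢ P b → Auto ((a , a′) ∷ (b , b′) ∷ [])
  auto₂ {a} {b} {a′} {b′} ea eb n =
    extend-to-auto (PartialIso-pair a≢b a′≢b′ ea eb) ((a≢b ∷ []) ∷ [] ∷ []) (here refl) (there (here refl)) n
    where
    a≢b : a ≢ b
    a≢b e = n (cong P e)
    a′≢b′ : a′ ≢ b′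
    a′≢b′ e = n (trans ea (trans (cong P e) (sym eb)))

  auto₃ : ∀ {a b c a′ b′ c′} → Distinct a b c → Distinct a′ b′ c′ →
    P a ≡ P a′ → P b ≡ P b′ → P c ≡ P c′ → P a ≢ P b →
    Auto ((a , a′) ∷ (b , b′) ∷ (c , c′) ∷ [])
  auto₃ dist@(apart ab ac bc) dist′ ea eb ec n =
    extend-to-auto (PartialIso-triple dist dist′ ea eb ec)
      ((ab ∷ ac ∷ []) ∷ (bc ∷ []) ∷ [] ∷ []) (here refl) (there (here refl)) n

  auto₄ : ∀ {a b c d a′ b′ c′ d′} →
    D a b c d → D a′ b′ c′ d′ → a ≢ b → a′ ≢ b′ → c ≢ d → c′ ≢ d′ →
    P a ≡ P a′ → P b ≡ P b′ → P c ≡ P c′ → P d ≡ P d′ → P b ≢ P c ⊎ P b ≢ P d →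
    Auto ((a , a′) ∷ (b , b′) ∷ (c , c′) ∷ (d , d′) ∷ [])
  auto₄ {a} {b} {c} {d} {a′} {b′} {c′} {d′} δ δ′ a≢b a′≢b′ c≢d c′≢d′ ea eb ec ed = go
    where
    L : Partial
    L = (a , a′) ∷ (b , b′) ∷ (c , c′) ∷ (d , d′) ∷ []
    iso : PartialIso L
    iso = PartialIso-quad δ δ′ a≢b a′≢b′ c≢d c′≢d′ ea eb ec ed
    dis : AllPairs (λ p q → proj₁ p ≢ proj₁ q) L
    dis = (a≢b ∷ ≢₁₃ δ ∷ ≢₁₄ δ ∷ []) ∷ (≢₂₃ δ ∷ ≢₂₄ δ ∷ []) ∷ (c≢d ∷ []) ∷ [] ∷ []
    go : P b ≢ P c ⊎ P b ≢ P d → Auto L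
    go (inj₁ n) = extend-to-auto iso dis (there (here refl)) (there (there (here refl))) n
    go (inj₂ n) = extend-to-auto iso dis (there (here refl)) (there (there (there (here refl)))) n

  -- Necessity: density

  Between : Ω → Ω → Ω → Ω → Ω → Set
  Between w x y z v = D v x y z × D w v y z × D w x v z × D w x y v

  -- The nodes spanned by w, x and by y, z are distinct and adjacent.
  record Gap (w x y z : Ω) : Set where
    constructor gap
    field
      rel   : D w x y z
      w≢x   : w ≢ x
      y≢z   : y ≢ z
      empty : ∀ {v} → ¬ Between w x y z v

  open Gap

  Gap-swapL : ∀ {w x y z} → Gap w x y z → Gap x w y z
  Gap-swapL (gap d n m e) = gap (swapL d) (≢-sym n) m
    λ { (b₁ , b₂ , b₃ , b₄) → e (swapL b₂ , swapL b₁ , swapL b₃ , swapL b₄) }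

  Gap-swapS : ∀ {w x y z} → Gap w x y z → Gap y z w x
  Gap-swapS (gap d n m e) = gap (swapS d) m n
    λ { (b₁ , b₂ , b₃ , b₄) → e (swapS b₃ , swapS b₄ , swapS b₁ , swapS b₂) }

  Gap-swapR : ∀ {w x y z} → Gap w x y z → Gap w x z y
  Gap-swapR g = Gap-swapS (Gap-swapL (Gap-swapS g))

  -- Outside the sector of `x` and on the side away from `yz`, the point `r` spans with `x` the node
  -- that `w` spans with `x`. Accordingly anything between `rx` and `yz` is between `wx` and `yz`.
  Gap-replace : ∀ {w x y z r} → Gap w x y z → D r x y z → ¬ D r x w y → Gap r x y z
  Gap-replace {w} {x} {y} {z} {r} (gap d w≢x y≢z e) δ n = gap δ
    (λ { refl → n (point (≢-sym w≢x) (≢₂₃ d)) }) y≢z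
    λ { (b₁ , _ , b₃ , b₄) → e (b₁ , join d (swapL b₁) , right b₃ b₄ , left b₄) }
    where
    left : ∀ {v} → D r x y v → D w x y v
    left b with split b w
    ... | inj₁ (f , _) = ⊥-elim (n (swapR f))
    ... | inj₂ (_ , f) = swapL f
    right : ∀ {v} → D r x v z → D r x y v → D w x v z
    right b b′ with split b w
    ... | inj₁ (f , _) = ⊥-elim (n (swapR (joinR b′ f)))
    ... | inj₂ (_ , f) = swapL f

  -- Properness gives `w′` in the sector of `w` at the node of the gap. Then `w′x|yz` is a gap too,
  -- isomorphic over `w′`, `y`, `z` to `w′w|yz`, in which `x` lies between; the preimage of `x` lies
  -- in the gap.
  no-gap-mono : ∀ {w x y z} → Gap w x y z → P w ≡ P x → P x ≢ P y ⊎ P x ≢ P z → ⊥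
  no-gap-mono {w} {x} {y} {z} g@(gap d w≢x y≢z e) wx bi
    with proj₂ proper x y w (≢₂₃ d) (≢-sym w≢x) (≢-sym (≢₁₃ d))
  ... | w′ , w′≢w , δ with split d w′
  ...   | inj₁ (f , _) = excl (swapR f) (swapS δ)
  ...   | inj₂ (ww′ , xw′) = empty g′
            ( pull (to-from x) (sends (there (here refl))) y↦ z↦ (swapL d)
            , pull w′↦ (to-from x) y↦ z↦ (swapL xw′)
            , pull w′↦ x↦ (to-from x) z↦ (swapL (joinR (swapS δ) ww′))
            , pull w′↦ x↦ y↦ (to-from x) (swapL (swapS (swapL δ))))
    where
    g′ : Gap w′ x y z
    g′ = Gap-replace g (swapL xw′) (excl (swapL (swapS δ)))
    open Auto (auto₄ (swapL xw′) (swapL ww′) (Gap.w≢x g′) w′≢w y≢z y≢z refl (sym wx) refl refl bi)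
    w′↦ = sends (here refl)
    x↦ = sends (there (here refl))
    y↦ = sends (there (there (here refl)))
    z↦ = sends (there (there (there (here refl))))

  -- An automorphism fixes `w` and takes `x` to `z`, so the images `r`, `s` of `y`, `z` satisfy
  -- `D w z r s`. Colours put `r` with `w` or `y` and `s` with `x` or `z`; at one end of the gap
  -- both `w`, `z` and `r`, `s` are then in different sectors.
  no-gap-mixed : ∀ {w x y z} → Gap w x y z → P w ≡ P y → P x ≡ P z → P w ≢ P x → ⊥
  no-gap-mixed {w} {x} {y} {z} g@(gap d w≢x y≢z e) wy xz wx = go (split d r) (split d s)
    where
    open Auto (auto₂ {w} {x} {w} {z} refl xz wx)
    r = to y
    s = to z
    image : D w z r s
    image = push (sends (here refl)) (sends (there (here refl))) refl refl d
    rw : P r ≡ P w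
    rw = trans (P-to y) (sym wy)
    sx : P s ≡ P x
    sx = trans (P-to z) (sym xz)
    -- A point coloured like `x` on its side is in its sector, for otherwise it could replace `w`
    -- and give the gap excluded by `no-gap-mono`.
    stays : ∀ {w x y z r} → Gap w x y z → P r ≡ P x → P x ≢ P y ⊎ P x ≢ P z → D r x y z → D r x w y
    stays {w} {x} {y} {z} {r} g rx bi δ with dec (D r x w y)
    ... | yes f = f
    ... | no n = ⊥-elim (no-gap-mono (Gap-replace g δ n) rx bi)
    module A = Apart (Sim-apart {w} {x} {y})
    module B = Apart (Sim-apart {y} {z} {w})
    zy : Sim w x y z y
    zy = inj₁ (swapL (swapS d))
    go₁ : ∀ {u} → Sim w x y r u → ¬ Sim w x y u s → ⊥
    go₁ ru us with Sim-four image
    ... | inj₁ wz = A.ac (Sim-trans wz zy)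
    ... | inj₂ rs = us (Sim-trans (Sim-sym ru) rs)
    wr-w : D w r y z → D r w x y
    wr-w f = stays (Gap-swapL g) rw (inj₂ (λ q → wx (trans q (sym xz)))) (swapL f)
    sx-x : D x s y z → D s x w y
    sx-x f = stays g sx (inj₁ (λ q → wx (trans wy (sym q)))) (swapL f)
    go : (D w x y r × D w x z r) ⊎ (D w r y z × D x r y z) →
         (D w x y s × D w x z s) ⊎ (D w s y z × D x s y z) → ⊥
    go (inj₂ (wr , _)) (inj₂ (_ , xs)) = go₁ {w} (inj₂ (inj₂ (wr-w wr)))
      (λ e → A.ab (Sim-trans e (inj₂ (inj₁ (sx-x xs)))))
    go (inj₂ (wr , _)) (inj₁ (ys , _)) = go₁ {w} (inj₂ (inj₂ (wr-w wr)))
      (λ e → A.ac (Sim-trans e (inj₁ (swapL (swapS ys)))))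
    go (inj₁ (yr , _)) (inj₂ (_ , xs)) = go₁ {y} (inj₁ (swapL (swapS yr)))
      (λ e → A.bc (Sim-sym (Sim-trans e (inj₂ (inj₁ (sx-x xs))))))
    go (inj₁ (yr , _)) (inj₁ (_ , zs)) with Sim-four {y} {z} {w} image
    ... | inj₁ wz = B.bc (Sim-sym wz)
    ... | inj₂ rs = B.ab (Sim-trans (Sim-sym (inj₂ (inj₂ ry))) (Sim-trans rs (inj₂ (inj₁ sz))))
      where
      ry : D r y z w
      ry = stays (Gap-swapL (Gap-swapS g)) (trans rw wy) (inj₂ (λ q → wx (trans wy q))) (swapL (swapS yr))
      sz : D s z y w
      sz = stays (Gap-swapS g) (trans sx xz) (inj₁ (λ q → wx (trans (sym q) (sym xz)))) (swapL (swapS zs))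

  no-gap-bichromatic : ∀ {w x y z} → Gap w x y z → P w ≢ P x ⊎ P x ≢ P y ⊎ P y ≢ P z → ⊥
  no-gap-bichromatic {w} {x} {y} {z} g bi with dec (P w ≡ P x) | dec (P y ≡ P z)
  ... | yes wx | _ = no-gap-mono g wx (right bi)
    where
    right : P w ≢ P x ⊎ P x ≢ P y ⊎ P y ≢ P z → P x ≢ P y ⊎ P x ≢ P z
    right (inj₁ n) = ⊥-elim (n wx)
    right (inj₂ (inj₁ n)) = inj₁ n
    right (inj₂ (inj₂ n)) with dec (P x ≡ P y)
    ... | yes e = inj₂ (λ q → n (trans (sym e) q))
    ... | no m = inj₁ m
  ... | no wx | yes yz = no-gap-mono (Gap-swapS g) yz right
    where
    right : P z ≢ P w ⊎ P z ≢ P x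
    right with dec (P z ≡ P w)
    ... | yes e = inj₂ (λ q → wx (trans (sym e) q))
    ... | no n = inj₁ n
  ... | no wx | no yz with dec (P w ≡ P y)
  ...   | yes wy = no-gap-mixed g wy (other wx yz wy) wx
    where
    other : ∀ {a b c d} → P a ≢ P b → P c ≢ P d → P a ≡ P c → P b ≡ P d
    other n m e = trans (¬-not (≢-sym n)) (trans (cong not e) (sym (¬-not (≢-sym m))))
  ...   | no wy = no-gap-mixed (Gap-swapR g)
            (trans (¬-not wy) (sym (¬-not (≢-sym yz)))) (trans (¬-not (≢-sym wx)) (sym (¬-not (≢-sym wy)))) wx

  -- The point `r` cannot be in the sectors of both `w` and `x`, so it can replace one of them.
  Gap-insert : ∀ {w x y z r} → Gap w x y z → D w r y z → D x r y z → Gap r x y z ⊎ Gap r w y z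
  Gap-insert {w} {x} {y} {r = r} g wr xr with dec (D r x w y)
  ... | no n = inj₁ (Gap-replace g (swapL xr) n)
  ... | yes f = inj₂ (Gap-replace (Gap-swapL g) (swapL wr) (excl f))

  -- Into a gap of a single colour a point of the other colour can be inserted on whichever side it
  -- lies, giving a bichromatic gap.
  no-gap : ∀ {w x y z} → ¬ Gap w x y z
  no-gap {w} {x} {y} {z} g with dec (P w ≡ P x) | dec (P x ≡ P y) | dec (P y ≡ P z)
  ... | no n | _ | _ = no-gap-bichromatic g (inj₁ n)
  ... | yes _ | no n | _ = no-gap-bichromatic g (inj₂ (inj₁ n))
  ... | yes _ | yes _ | no n = no-gap-bichromatic g (inj₂ (inj₂ n))
  ... | yes wx | yes xy | yes yz with inhabited (not (P x))
  ...   | r , rx = [ (λ (yr , zr) → [ odd (sym (trans xy yz)) , odd (sym xy) ]′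
                       (Gap-insert (Gap-swapS g) (swapS yr) (swapS zr)))
                   , (λ (wr , xr) → [ odd refl , odd wx ]′ (Gap-insert g wr xr)) ]′ (split (rel g) r)
    where
    odd : ∀ {a b c} → P a ≡ P x → ¬ Gap r a b c
    odd e g′ = no-gap-bichromatic g′ (inj₁ (λ q → not-¬ (trans q e) rx))

  dense : IsDense D
  dense = (let (a , b , _ , a≢b , _) = proj₁ proper in a , b , a≢b) , between
    where
    thin : ∀ {w y z} → D w w y z → y ≢ z → Σ Ω (Between w w y z)
    thin d y≢z with proj₂ proper _ _ _ y≢z (≢-sym (≢₁₃ d)) (≢-sym (≢₁₄ d))
    ... | v , v≢w , δ = v , swapL (swapS δ) , swapS δ , point (≢-sym v≢w) (≢₁₄ d) , point (≢₁₃ d) (≢-sym v≢w)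
    third : ∀ {w y} → w ≢ y → Σ Ω λ v → w ≢ v × y ≢ v
    third {w} {y} w≢y with proj₁ proper
    ... | a , b , c , ab , ac , bc with dec (w ≡ a) | dec (y ≡ a)
    ...   | no m | no n = a , m , n
    ...   | yes refl | _ with dec (y ≡ b)
    ...     | no n = b , ab , n
    ...     | yes refl = c , ac , bc
    third {w} {y} w≢y | a , b , c , ab , ac , bc | no m | yes refl with dec (w ≡ b)
    ...     | no n = b , n , ab
    ...     | yes refl = c , bc , ac
    flip : ∀ {w x y z} → Σ Ω (Between y z w x) → Σ Ω (Between w x y z)
    flip (v , b₁ , b₂ , b₃ , b₄) = v , swapS b₃ , swapS b₄ , swapS b₁ , swapS b₂
    between : ∀ w x y z → D w x y z → Σ Ω (Between w x y z)
    between w x y z d with dec (w ≡ x) | dec (y ≡ z)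
    ... | yes refl | no n = thin d n
    ... | no n | yes refl = flip (thin (swapS d) n)
    ... | yes refl | yes refl with third (≢₁₃ d)
    ...   | v , w≢v , y≢v = v , D4 _ _ _ (≢-sym y≢v) (≢₁₃ d) , D4 _ _ _ (≢₁₃ d) (≢-sym y≢v)
            , point w≢v (≢₁₃ d) , point (≢₁₃ d) w≢v
    between w x y z d | no m | no n with dec (Σ Ω (Between w x y z))
    ... | yes r = r
    ... | no none = ⊥-elim (no-gap (gap d m n (λ b → none (_ , b))))

  -- Necessity: condition (3)

  module _ (several : ∀ k → ¬ ExactlyOne D P k) where

    another : ∀ {k x} → P x ≡ k → Σ Ω λ y → P y ≡ k × y ≢ x
    another {k} {x} e with dec (Σ Ω λ y → P y ≡ k × y ≢ x)
    ... | yes r = r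
    ... | no none = ⊥-elim (several k (x , e , only))
      where
      only : ∀ y → P y ≡ k → y ≡ x
      only y ey with dec (y ≡ x)
      ... | yes q = q
      ... | no n = ⊥-elim (none (y , ey , n))

    -- All triples with the same colours are isomorphic, so one pair of points
    -- separated from a whole colour class forces every such pair to be.
    separated : ∀ {k q q′} → P q ≡ k → P q′ ≡ k → q ≢ q′ →
      (∀ {p p′} → P p ≢ k → P p′ ≢ k → D q q′ p p′) →
      ∀ {r r′} → P r ≡ k → P r′ ≡ k → ∀ {p p′} → P p ≢ k → P p′ ≢ k → D r r′ p p′
    separated {k} {q} {q′} qk q′k q≢q′ sep {r} {r′} rk r′k {p} {p′} pk p′k with dec (r ≡ r′)
    ... | yes refl = point (λ e → pk (trans (cong P (sym e)) rk)) (λ e → p′k (trans (cong P (sym e)) rk))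
    ... | no r≢r′ = push (sends (there (here refl))) (sends (there (there (here refl)))) (sends (here refl))
                      (to-from p′) (sep pk (λ e → p′k (trans (sym (P-from p′)) e)))
      where
      p≢ : ∀ {x} → P x ≡ k → p ≢ x
      p≢ xk e = pk (trans (cong P e) xk)
      open Auto (auto₃ (apart (p≢ qk) (p≢ q′k) q≢q′) (apart (p≢ rk) (p≢ r′k) r≢r′)
                   refl (trans qk (sym rk)) (trans q′k (sym r′k)) (λ e → pk (trans e qk)))

    -- Two of three sectors have one colour. For `u`, `v` in them, properness and a point `r` of the
    -- other colour give `u′` beside `u`; moving `u′` to `v` while fixing `r` and `u` turns a sector
    -- relation into one that would merge `u` with `v`, or merge the two colours.
    no-node-refinement : ∀ (J : Set) (g : Ω → J) → Refines D (Whole D P) g P → ¬ IsNodeSplitting D (Whole D P) J g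
    no-node-refinement J g ref (spl , x , y , z , _ , _ , _ , xy , xz , yz) = go (dec (P x ≡ P y)) (dec (P x ≡ P z))
      where
      open SplittingProperties spl
      same-sector : ∀ {u v} → P u ≡ P v → g u ≢ g v → ⊥
      same-sector {u} {v} uv gu≢gv with inhabited (not (P u))
      ... | r , ru = contra (proj₂ proper v r u v≢r v≢u r≢u)
        where
        P-r : ∀ {x} → P x ≡ P u → P r ≢ P x
        P-r xu e = not-¬ (trans e xu) ru
        r≢ : ∀ {x} → P x ≡ P u → r ≢ x
        r≢ xu e = P-r xu (cong P e)
        r≢u = r≢ refl
        v≢r = ≢-sym (r≢ (sym uv))
        v≢u : v ≢ u
        v≢u e = gu≢gv (cong g (sym e))
        contra : (Σ Ω λ u′ → u′ ≢ u × D v r u u′) → ⊥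
        contra (u′ , u′≢u , d) with fourStrong tt tt tt tt d
        ... | inj₁ vr = P-r (sym uv) (sym (ref v r tt tt vr))
        ... | inj₂ uu′ = [ gu≢gv , (λ e → P-r (trans (P-to v) (sym uv)) (ref r (to v) tt tt e)) ]′
                           (fourStrong tt tt tt tt moved)
          where
          u′u : P u′ ≡ P u
          u′u = ref u′ u tt tt (sym uu′)
          open Auto (auto₃ (apart r≢u (r≢ u′u) (≢-sym u′≢u)) (apart r≢u (≢-sym v≢r) (≢-sym v≢u))
                       refl refl (trans u′u uv) (P-r refl))
          moved : D u v r (to v)
          moved = push (sends (there (here refl))) (sends (there (there (here refl)))) (sends (here refl)) refl
            (IsSplitting.sectorCond spl u u′ r v tt tt tt tt uu′
              (λ e → P-r refl (ref r u tt tt e)) (≢-sym gu≢gv))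
      go : Dec (P x ≡ P y) → Dec (P x ≡ P z) → ⊥
      go (yes e) _ = same-sector e xy
      go (no _) (yes e) = same-sector e xz
      go (no m) (no n) = same-sector (trans (¬-not (≢-sym m)) (sym (¬-not (≢-sym n)))) yz

    -- All points of the missing colour lie outside the sector, so two points of the sector are
    -- separated from that whole colour class, which is what `separated` spreads to all points.
    monochrome⇒true-edge : ∀ {I} {f : Ω → I} → IsSplitting D (Whole D P) I f → ∀ i →
      Infinite (λ x → f x ≡ i) → ∀ k → ¬ (Σ Ω λ x → f x ≡ i × P x ≡ k) → PartitionIsTrueEdge D P
    monochrome⇒true-edge {I} {f} spl i inf k none with infinite⇒two inf
    ... | q , q′ , qi , q′i , q≢q′ = (edge , λ (_ , _ , _ , _ , _ , _ , m , n , o) → three-Bools m n o)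
        , no-node-refinement , singleton
      where
      in-sector : ∀ {x} → f x ≡ i → P x ≡ not k
      in-sector e = ¬-not (λ xk → none (_ , e , xk))
      out : ∀ {p} → P p ≢ not k → f p ≢ f q
      out n e = n (in-sector (trans e qi))
      apart-k : ∀ {r r′} → P r ≡ not k → P r′ ≡ not k → ∀ {p p′} → P p ≢ not k → P p′ ≢ not k → D r r′ p p′
      apart-k = separated (in-sector qi) (in-sector q′i) q≢q′
        (λ n n′ → IsSplitting.sectorCond spl _ _ _ _ tt tt tt tt (trans qi (sym q′i)) (out n) (out n′))
      cond : ∀ a b c d → P a ≡ P b → P c ≢ P a → P d ≢ P a → D a b c d
      cond a b c d ab ca da with dec (P a ≡ not k)
      ... | yes e = apart-k e (trans (sym ab) e) (λ q → ca (trans q (sym e))) (λ q → da (trans q (sym e)))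
      ... | no n = swapS (apart-k (flip ca) (flip da) n (λ e → n (trans ab e)))
        where
        flip : ∀ {x} → P x ≢ P a → P x ≡ not k
        flip m = trans (¬-not m) (sym (¬-not (≢-sym n)))
      edge : IsSplitting D (Whole D P) Bool P
      edge = record
        { onto = λ k → proj₁ (inhabited k) , tt , proj₂ (inhabited k)
        ; twoParts = _ , _ , tt , tt , λ e → not-¬ {true} refl
            (trans (sym (proj₂ (inhabited true))) (trans e (proj₂ (inhabited false))))
        ; sectorCond = λ a b c d _ _ _ _ → cond a b c d
        ; fourCond = λ _ _ _ _ _ _ _ _ m n _ o _ _ _ → three-Bools m n o }
      singleton : ¬ HasSingletonSector D (Whole D P) P
      singleton (x , _ , only) with another {x = x} refl
      ... | y , e , n = n (only y tt e)

  -- The decision is an argument because `PartitionIsTrueEdge` lives in `Set₁`, outside the range of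
  -- `dec`.
  trichotomy : Dec (PartitionIsTrueEdge D P) → Trichotomy
  trichotomy (yes e) = inj₂ (inj₁ e)
  trichotomy (no ¬edge) with dec (ExactlyOne D P true) | dec (ExactlyOne D P false)
  ... | yes e | _ = inj₂ (inj₂ (inj₁ e))
  ... | no _ | yes e = inj₂ (inj₂ (inj₂ e))
  ... | no m | no n = inj₁ λ I f spl i inf → meets spl inf true , meets spl inf false
    where
    several : ∀ k → ¬ ExactlyOne D P k
    several true = m
    several false = n
    meets : ∀ {I} {f : Ω → I} {i} → IsSplitting D (Whole D P) I f → Infinite (λ x → f x ≡ i) →
      ∀ k → Σ Ω λ x → f x ≡ i × P x ≡ k
    meets {f = f} {i} spl inf k with dec (Σ Ω λ x → f x ≡ i × P x ≡ k)
    ... | yes r = r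
    ... | no none = ⊥-elim (¬edge (monochrome⇒true-edge several spl i inf k none))

  -- Necessity: condition (2)

  module _ (tri : Trichotomy) (k : Bool) where

    -- All anchors are isomorphic, and p₁, p₂, p₃ determine the splitting.
    record Anchor {I : Set} (f : Ω → I) : Set where
      field
        {p₁ p₂ p₃ q}   : Ω
        P₁             : P p₁ ≡ k
        P₂             : P p₂ ≡ k
        P₃             : P p₃ ≡ k
        Pq             : P q ≡ not k
        sectors-differ : Apart (λ x y → f x ≡ f y) p₁ p₂ p₃
        rel            : D p₁ p₂ p₃ q

      distinct : Distinct p₁ p₂ p₃
      distinct with sectors-differ
      ... | apart m n o = apart (λ e → m (cong f e)) (λ e → n (cong f e)) (λ e → o (cong f e))

    -- The sector of a point `q` of the other colour contains some `r` of colour `k`. Two of `a`,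
    -- `b`, `c` lie outside that sector and complete the anchor, with `r` as `p₃`.
    anchor : ∀ {I} {f : Ω → I} → IsNodeSplitting D (Colour k) I f → Anchor f
    anchor {I} {f} (spl , a , b , c′ , pa , pb , pc , ab , ac , bc) = go (dec (r ~ a)) (dec (r ~ b))
      where
      open SplittingProperties spl
      ap : Apart (λ x y → f x ≡ f y) a b c′
      ap = apart ab ac bc
      _~_ : Ω → Ω → Set
      _~_ = Sim a b c′
      dist : Distinct a b c′
      dist = apart (λ e → ab (cong f e)) (λ e → ac (cong f e)) (λ e → bc (cong f e))
      open NodeProperties (Sim-node dist)
      q = proj₁ (inhabited (not k))
      found = sectors-meet-majority dense tri dist pa pb q
      r = proj₁ found
      rk : P r ≡ k
      rk = proj₁ (proj₂ found)
      make : ∀ {u v} → P u ≡ k → P v ≡ k → f u ≢ f v → ¬ (r ~ u) → ¬ (r ~ v) → Anchor f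
      make uk vk uv ru rv = record
        { P₁ = uk ; P₂ = vk ; P₃ = rk ; Pq = proj₂ (inhabited (not k))
        ; sectors-differ = apart uv (λ e → ru (≡⇒Sim pa pb pc ap rk uk (sym e)))
                                    (λ e → rv (≡⇒Sim pa pb pc ap rk vk (sym e)))
        ; rel = swapS (sector (proj₂ (proj₂ found)) ru rv) }
      go : Dec (r ~ a) → Dec (r ~ b) → Anchor f
      go (yes s) _ = make pb pc bc (λ t → Apart.ab Sim-apart (~-trans (~-sym s) t))
                                   (λ t → Apart.ac Sim-apart (~-trans (~-sym s) t))
      go (no n) (yes s) = make pa pc ac n (λ t → Apart.bc Sim-apart (~-trans (~-sym s) t))
      go (no m) (no n) = make pa pb ab m n

    -- An automorphism matching the two anchors takes the first three points of one to those of the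
    -- other. These determine the splittings, so it carries the sectors of `f` to the sectors of
    -- `g`.
    equinumerous : NodeSplittingsEquinumerous D (Colour k)
    equinumerous I J f g nf ng = mk↔ₛ′
        (λ i → g (to (F.rep i))) (λ j → f (from (G.rep j)))
        (λ j → trans (f⇒g (F.rep-in _) (from-in j) (F.rep-label _)) (trans (cong g (to-from _)) (G.rep-label j)))
        (λ i → trans (g⇒f (from-in _) (F.rep-in i) (trans (cong g (to-from _)) (G.rep-label _))) (F.rep-label i))
      where
      module Rep {K : Set} {h : Ω → K} (spl : IsSplitting D (Colour k) K h) where
        rep : K → Ω
        rep i = proj₁ (IsSplitting.onto spl i)
        rep-in : ∀ i → P (rep i) ≡ k
        rep-in i = proj₁ (proj₂ (IsSplitting.onto spl i))
        rep-label : ∀ i → h (rep i) ≡ i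
        rep-label i = proj₂ (proj₂ (IsSplitting.onto spl i))
      module F = Rep (proj₁ nf)
      module G = Rep (proj₁ ng)
      module A = Anchor (anchor nf)
      module B = Anchor (anchor ng)
      open Auto (auto₄ A.rel B.rel (Apart.ab A.distinct) (Apart.ab B.distinct)
        (λ e → not-¬ A.P₃ (trans (cong P e) A.Pq)) (λ e → not-¬ B.P₃ (trans (cong P e) B.Pq))
        (trans A.P₁ (sym B.P₁)) (trans A.P₂ (sym B.P₂)) (trans A.P₃ (sym B.P₃)) (trans A.Pq (sym B.Pq))
        (inj₂ (λ e → not-¬ A.P₂ (trans e A.Pq))))
      ↦₁ = sends (here refl)
      ↦₂ = sends (there (here refl))
      ↦₃ = sends (there (there (here refl)))
      to-in : ∀ {x} → P x ≡ k → P (to x) ≡ k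
      to-in e = trans (P-to _) e
      from-in : ∀ j → P (from (G.rep j)) ≡ k
      from-in j = trans (P-from _) (G.rep-in j)
      f⇒g : ∀ {x y} → P x ≡ k → P y ≡ k → f x ≡ f y → g (to x) ≡ g (to y)
      f⇒g xk yk e = SplittingProperties.Sim⇒≡ (proj₁ ng) B.P₁ B.P₂ B.P₃ B.sectors-differ (to-in xk) (to-in yk)
        (move (SplittingProperties.≡⇒Sim (proj₁ nf) A.P₁ A.P₂ A.P₃ A.sectors-differ xk yk e))
        where
        move : ∀ {x y} → Sim A.p₁ A.p₂ A.p₃ x y → Sim B.p₁ B.p₂ B.p₃ (to x) (to y)
        move (inj₁ d) = inj₁ (push refl refl ↦₁ ↦₂ d)
        move (inj₂ (inj₁ d)) = inj₂ (inj₁ (push refl refl ↦₁ ↦₃ d))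
        move (inj₂ (inj₂ d)) = inj₂ (inj₂ (push refl refl ↦₂ ↦₃ d))
      g⇒f : ∀ {x y} → P x ≡ k → P y ≡ k → g (to x) ≡ g (to y) → f x ≡ f y
      g⇒f xk yk e = SplittingProperties.Sim⇒≡ (proj₁ nf) A.P₁ A.P₂ A.P₃ A.sectors-differ xk yk
        (move (SplittingProperties.≡⇒Sim (proj₁ ng) B.P₁ B.P₂ B.P₃ B.sectors-differ (to-in xk) (to-in yk) e))
        where
        move : ∀ {x y} → Sim B.p₁ B.p₂ B.p₃ (to x) (to y) → Sim A.p₁ A.p₂ A.p₃ x y
        move (inj₁ d) = inj₁ (pull refl refl ↦₁ ↦₂ d)
        move (inj₂ (inj₁ d)) = inj₂ (inj₁ (pull refl refl ↦₁ ↦₃ d))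
        move (inj₂ (inj₂ d)) = inj₂ (inj₂ (pull refl refl ↦₂ ↦₃ d))

mainTheorem13 : ExcludedMiddle (lsuc lzero) →
    (Ω : Set) (D : Ω → Ω → Ω → Ω → Set) (P : Ω → Bool) →
    IsDSet D → IsProper D → Countable Ω →
    (Σ Ω λ x → P x ≡ true) → (Σ Ω λ x → P x ≡ false) →
    (PHomogeneous D P
      ⇔ (IsDense D
         × (NodeSplittingsEquinumerous D (InP D P)
            × NodeSplittingsEquinumerous D (OutP D P))
         × (InfiniteSectorsMeetBoth D P
            ⊎ PartitionIsTrueEdge D P
            ⊎ (ExactlyOne D P true ⊎ ExactlyOne D P false))))
mainTheorem13 em Ω D P isD proper (c , c-inj) inP outP = mk⇔ necessary sufficient
  where
  dec : (A : Set) → Dec A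
  -- Excluded middle is taken one level up, where condition (b) lives, and reaches `Set` through
  -- `Lift`.
  dec A = map′ lower lift (em {Lift (lsuc lzero) A})

  inhabited : ∀ k → Σ Ω λ x → P x ≡ k
  inhabited true = inP
  inhabited false = outP

  necessary : PHomogeneous D P → _
  necessary hom = dense , (equinumerous tri true , equinumerous tri false) , tri
    where
    open Necessity isD dec P c c-inj proper inhabited hom
    tri = trichotomy em

  sufficient : _ → PHomogeneous D P
  sufficient (dense , (eqP , eqQ) , tri) =
    Extension.homogeneous isD dec P c c-inj dense (λ { true → eqP ; false → eqQ }) tri
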